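{- For every fixed $r\ge 3$, as $t\to\infty$, \[ (1+o(1))\frac{\sqrt{2}}{e}\, t\, \sqrt{2}^{\,t} < R^r(SK_t,SK_t)\le R^2(K_t,K_t)+(r-2). \]
   Context: For a graph $G=(V,E)$ and $r\ge 3$, the $r$-suspension $SG$ is the $r$-uniform hypergraph obtained by taking a fixed set $U$ of $r-2$ new vertices and setting $V(SG)=V\cup U$, $E(SG)=\{e\cup U: e\in E\}$. $K_t$ is the complete graph on $t$ vertices. For $r$-uniform hypergraphs $\mathcal{F}_1,\mathcal{F}_2$, $R^r(\mathcal{F}_1,\mathcal{F}_2)$ is the least $N$ such that every 2-coloring of the hyperedges of the complete $r$-uniform hypergraph on $N$ vertices contains a subhypergraph of the first color isomorphic to $\mathcal{F}_1$ or one of the second color isomorphic to $\mathcal{F}_2$; $R^2(K_t,K_t)$ is the classical graph Ramsey number. -}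

module Defs where

open import Data.Nat using (ℕ; zero; suc; _+_; _*_; _∸_; _^_; _≤_; _<_)
open import Data.Fin using (Fin)
open import Data.Fin.Subset using (Subset; ⋃; ⁅_⁆; ∣_∣; inside; outside)
import Data.Fin.Subset as S
open import Data.Bool using (Bool; true; false; if_then_else_)
open import Data.List using (List; map; allFin)
open import Data.Vec using (Vec; lookup; replicate; _++_)
open import Data.Product using (Σ; ∃; _×_)
open import Data.Sum using (_⊎_)
open import Relation.Binary.PropositionalEquality using (_≡_)
open import Relation.Nullary using (¬_)
open import Function.Definitions using (Injective)

record Hypergraph : Set₁ where
  field
    V : ℕ
    E : Subset V → Set
open Hypergraph public

image : ∀ {m n} → (Fin m → Fin n) → Subset m → Subset n
image {m} φ e = ⋃ (map (λ x → if lookup e x then ⁅ φ x ⁆ else S.⊥) (allFin m))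

K : ℕ → Hypergraph
K t = record { V = t ; E = λ s → ∣ s ∣ ≡ 2 }

-- The r-suspension SG of a graph G: new vertices U = the last (r-2) vertices,
-- edges e ∪ U for edges e of G.
Susp : ℕ → Hypergraph → Hypergraph
Susp r G = record
  { V = V G + (r ∸ 2)
  ; E = λ s → Σ (Subset (V G)) (λ g → E G g × (s ≡ g ++ replicate (r ∸ 2) inside)) }

SK : ℕ → ℕ → Hypergraph
SK r t = Susp r (K t)

-- A 2-colouring of the hyperedges of the complete hypergraph on Fin N
-- (only its values on r-subsets matter).
Colouring : ℕ → Set
Colouring N = Subset N → Bool

HasCopy : ∀ {N} → Colouring N → Bool → Hypergraph → Set
HasCopy {N} χ c F =
  Σ (Fin (V F) → Fin N) (λ φ →
    Injective _≡_ _≡_ φ × (∀ e → E F e → χ (image φ e) ≡ c))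

Arrows : ℕ → Hypergraph → Hypergraph → Set
Arrows N F₁ F₂ = ∀ (χ : Colouring N) → HasCopy χ true F₁ ⊎ HasCopy χ false F₂

IsRamseyNumber : Hypergraph → Hypergraph → ℕ → Set
IsRamseyNumber F₁ F₂ R = Arrows R F₁ F₂ × (∀ M → M < R → ¬ Arrows M F₁ F₂)

{-# OPTIONS --safe #-}
-- Lower bound: the Lovász local lemma in Rosenfeld's counting form. Colour the r-sets uniformly and,
-- for a set S of r-sets, let P S count the colourings without monochromatic copy inside S. Induction
-- on |S| gives P (S ∪ {e}) ≥ (1 - 1/2m) P S with m = C(t,2): a colouring lost by adding e has a
-- monochromatic copy B through e and still avoids S ∖ B, so by independence there are at most
-- 2^(1-m) P (S ∖ B) ≤ 2^(2-m) P S of them for each B. An r-set lies in at most r² C(R,t-2) copies,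
-- hence R cannot be a Ramsey number as soon as 8 m r² C(R,t-2) ≤ 2^m. With k = t - 2,
-- C(R,k) ≤ R^k / k! and k! ≳ (k/e)^k this holds for R ≤ (√2/e - ε) t √2^t, and the factor r² is
-- lost in the k-th root.
-- Upper bound: in a colouring on R₂ + (r-2) vertices, the link of the last r-2 vertices is a
-- 2-coloured complete graph on R₂ vertices.
module Submission where

open import Defs
open import Data.Bool using (Bool; true; false; not; if_then_else_)
open import Data.Bool.Properties using () renaming (_≟_ to _≟ᵇ_)
open import Data.Empty using (⊥-elim) renaming (⊥ to ⊥₀)
open import Data.Fin using (Fin; zero; suc; _↑ˡ_; _↑ʳ_; splitAt; join)
open import Data.Fin.Properties using (↑ˡ-injective; ↑ʳ-injective; splitAt-↑ˡ; splitAt-↑ʳ; splitAt⁻¹-↑ˡ; splitAt⁻¹-↑ʳ) renaming (_≟_ to _≟ᶠ_)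
open import Data.Fin.Subset using (Subset; ⋃; ⁅_⁆; ∣_∣; inside; outside; _∪_; _─_; _-_; ⊤; ⊥) renaming (_∈_ to _∈ˢ_; _∉_ to _∉ˢ_)
open import Data.Fin.Subset.Properties using (x∈⁅x⁆; x∈⁅y⁆⇒x≡y; x∈p∪q⁻; x∈p∪q⁺; ⊆-antisym; ∉⊥; ∈⊤; p─q⊆p; x∈p∧x≢y⇒x∈p-y; ∪-identityˡ; ∪-identityʳ; ∣⁅x⁆∣≡1) renaming (_∈?_ to _∈ˢ?_)
open import Data.List using (List; []; _∷_; length; filter; concat; map; _++_; allFin; tabulate; cartesianProduct)
open import Data.List.Properties using (length-filter; filter-notAll; length-map; length-++; length-tabulate)
open import Data.List.Membership.Propositional using (_∈_; _∉_; find)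
open import Data.List.Membership.Propositional.Properties using (∈-filter⁺; ∈-filter⁻; ∈-concat⁺′; ∈-∃++; ∈-++⁺ˡ; ∈-++⁺ʳ; ∈-++⁻; ∈-map⁺; ∈-map⁻; ∈-allFin; ∈-cartesianProduct⁺; ∈-tabulate⁺; ∈-tabulate⁻)
open import Data.List.Relation.Unary.All as All using (All; []; _∷_)
open import Data.List.Relation.Unary.All.Properties using (¬All⇒Any¬)
open import Data.List.Relation.Unary.Any as Any using (here; there)
open import Data.List.Relation.Unary.AllPairs using ([]; _∷_)
import Data.List.Relation.Unary.Unique.DecPropositional as UniqueDec
open import Data.List.Relation.Unary.Unique.Propositional using (Unique)
import Data.List.Relation.Unary.Unique.Propositional.Properties as Unique
open import Data.Nat
open import Data.Nat.ListAction using (sum)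
open import Data.Nat.Properties
open import Data.Nat.Tactic.RingSolver using (solve-∀)
open import Data.Product using (Σ; ∃; _×_; _,_; proj₁; proj₂)
open import Data.Sum as Sum using (_⊎_; inj₁; inj₂)
open import Data.Vec as Vec using ([]; _∷_; lookup; here; there)
open import Data.Vec.Properties using ([]=⇒lookup; lookup⇒[]=; ≡-dec)
open import Function using (_∘_; id)
open import Function.Definitions using (Injective)
open import Relation.Binary.PropositionalEquality
open import Relation.Nullary using (¬_; Dec; yes; no; ¬?; contradiction)
open import Relation.Nullary.Decidable using (_→-dec_; _⊎-dec_; _×-dec_)

-- Counting colourings and the local lemma

-- A 2-colouring of all subsets of Fin n, as a finite sample space: the two
-- components colour the subsets omitting and containing the first vertex.
Col : ℕ → Set
Col zero    = Bool
Col (suc n) = Col n × Col n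

look : ∀ {n} → Col n → Subset n → Bool
look c       []          = c
look (l , r) (false ∷ s) = look l s
look (l , r) (true ∷ s)  = look r s

flipAt : ∀ {n} → Subset n → Col n → Col n
flipAt []          c       = not c
flipAt (false ∷ s) (l , r) = flipAt s l , r
flipAt (true ∷ s)  (l , r) = l , flipAt s r

look-flipAt-≡ : ∀ {n} (s : Subset n) χ → look (flipAt s χ) s ≡ not (look χ s)
look-flipAt-≡ []          χ       = refl
look-flipAt-≡ (false ∷ s) (l , r) = look-flipAt-≡ s l
look-flipAt-≡ (true ∷ s)  (l , r) = look-flipAt-≡ s r

look-flipAt-≢ : ∀ {n} (s u : Subset n) χ → s ≢ u → look (flipAt s χ) u ≡ look χ u
look-flipAt-≢ []          []          χ       s≢u = contradiction refl s≢u
look-flipAt-≢ (false ∷ s) (false ∷ u) (l , r) s≢u = look-flipAt-≢ s u l (s≢u ∘ cong (false ∷_))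
look-flipAt-≢ (false ∷ s) (true ∷ u)  (l , r) s≢u = refl
look-flipAt-≢ (true ∷ s)  (false ∷ u) (l , r) s≢u = refl
look-flipAt-≢ (true ∷ s)  (true ∷ u)  (l , r) s≢u = look-flipAt-≢ s u r (s≢u ∘ cong (true ∷_))

∑ : ∀ {n} → (Col n → ℕ) → ℕ
∑ {zero}  f = f true + f false
∑ {suc n} f = ∑ λ l → ∑ λ r → f (l , r)

∑-mono : ∀ {n} {f g : Col n → ℕ} → (∀ χ → f χ ≤ g χ) → ∑ f ≤ ∑ g
∑-mono {zero}  f≤g = +-mono-≤ (f≤g true) (f≤g false)
∑-mono {suc n} f≤g = ∑-mono λ l → ∑-mono λ r → f≤g (l , r)

∑-cong : ∀ {n} {f g : Col n → ℕ} → (∀ χ → f χ ≡ g χ) → ∑ f ≡ ∑ g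
∑-cong {zero}  f≡g = cong₂ _+_ (f≡g true) (f≡g false)
∑-cong {suc n} f≡g = ∑-cong λ l → ∑-cong λ r → f≡g (l , r)

∑-+ : ∀ {n} (f g : Col n → ℕ) → ∑ (λ χ → f χ + g χ) ≡ ∑ f + ∑ g
∑-+ {zero}  f g = lemma (f true) (g true) (f false) (g false)
  where
  lemma : ∀ a b c d → a + b + (c + d) ≡ a + c + (b + d)
  lemma = solve-∀
∑-+ {suc n} f g = trans (∑-cong λ l → ∑-+ (λ r → f (l , r)) (λ r → g (l , r)))
                        (∑-+ (λ l → ∑ λ r → f (l , r)) (λ l → ∑ λ r → g (l , r)))

∑-0 : ∀ {n} → ∑ {n} (λ _ → 0) ≡ 0
∑-0 {zero}  = refl
∑-0 {suc n} = trans (∑-cong {n} λ _ → ∑-0 {n}) (∑-0 {n})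

-- Flipping the colour of one set permutes the colourings, so the uniform measure is preserved;
-- independence below rests on this.
∑-flipAt : ∀ {n} (s : Subset n) (f : Col n → ℕ) → ∑ (f ∘ flipAt s) ≡ ∑ f
∑-flipAt []          f = +-comm (f false) (f true)
∑-flipAt (false ∷ s) f = ∑-flipAt s (λ l → ∑ λ r → f (l , r))
∑-flipAt (true ∷ s)  f = ∑-cong λ l → ∑-flipAt s (λ r → f (l , r))

∑-positive : ∀ {n} {f : Col n → ℕ} → (∀ χ → 0 < f χ) → 0 < ∑ f
∑-positive {zero}  0<f = <-≤-trans (0<f true) (m≤m+n _ _)
∑-positive {suc n} 0<f = ∑-positive λ l → ∑-positive λ r → 0<f (l , r)

∑-witness : ∀ {n} (f : Col n → ℕ) → 0 < ∑ f → ∃ λ χ → 0 < f χ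
∑-witness {zero} f 0<∑ with f true in eq
... | suc _ = true , subst (0 <_) (sym eq) z<s
... | zero  = false , 0<∑
∑-witness {suc n} f 0<∑ =
  let l , 0<∑l = ∑-witness (λ l → ∑ λ r → f (l , r)) 0<∑
      r , 0<f  = ∑-witness (λ r → f (l , r)) 0<∑l
  in (l , r) , 0<f

∑-sum : ∀ {n} {I : Set} (f : I → Col n → ℕ) (is : List I) →
        ∑ (λ χ → sum (map (λ i → f i χ) is)) ≡ sum (map (λ i → ∑ (f i)) is)
∑-sum {n} f []       = ∑-0 {n}
∑-sum     f (i ∷ is) = trans (∑-+ (f i) _) (cong (∑ (f i) +_) (∑-sum f is))

≤sum : ∀ {I : Set} (f : I → ℕ) {i is} → i ∈ is → f i ≤ sum (map f is)
≤sum f (here refl) = m≤m+n _ _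
≤sum f (there i∈)  = ≤-trans (≤sum f i∈) (m≤n+m _ _)

sum-bound : ∀ {I : Set} c (f : I → ℕ) B is → (∀ {i} → i ∈ is → c * f i ≤ B) →
            c * sum (map f is) ≤ length is * B
sum-bound c f B []       bound = ≤-reflexive (*-zeroʳ c)
sum-bound c f B (i ∷ is) bound = begin
  c * (f i + sum (map f is))   ≡⟨ *-distribˡ-+ c (f i) _ ⟩
  c * f i + c * sum (map f is) ≤⟨ +-mono-≤ (bound (here refl)) (sum-bound c f B is (bound ∘ there)) ⟩
  B + length is * B            ∎
  where open ≤-Reasoning

-- Indicators of events and independence.

ind : ∀ {P : Set} → Dec P → ℕ
ind (yes _) = 1
ind (no _)  = 0

ind-mono : ∀ {P Q : Set} (P? : Dec P) (Q? : Dec Q) → (P → Q) → ind P? ≤ ind Q?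
ind-mono (no _)  _        _ = z≤n
ind-mono (yes p) (yes _)  _ = ≤-refl
ind-mono (yes p) (no ¬q) pq = contradiction (pq p) ¬q

ind-true : ∀ {P : Set} (P? : Dec P) → P → 1 ≤ ind P?
ind-true (yes _) _ = ≤-refl
ind-true (no ¬p) p = contradiction p ¬p

ind-witness : ∀ {P : Set} (P? : Dec P) → 0 < ind P? → P
ind-witness (yes p) _ = p

-- Indicator of the event that all sets in `A` have colour `c`, written as a product so that one
-- edge can be split off at a time.
hit : ∀ {n} → Bool → List (Subset n) → Col n → ℕ
hit c []      χ = 1
hit c (a ∷ A) χ = ind (look χ a ≟ᵇ c) * hit c A χ

hit-constant : ∀ {n} c (A : List (Subset n)) χ → All (λ a → look χ a ≡ c) A → 1 ≤ hit c A χ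
hit-constant c []      χ []       = ≤-refl
hit-constant c (a ∷ A) χ (eq ∷ h) = *-mono-≤ (ind-true (look χ a ≟ᵇ c) eq) (hit-constant c A χ h)

hit-flipAt : ∀ {n} c (A : List (Subset n)) s χ → s ∉ A → hit c A (flipAt s χ) ≡ hit c A χ
hit-flipAt c []      s χ s∉ = refl
hit-flipAt c (a ∷ A) s χ s∉ =
  cong₂ _*_ (cong (λ x → ind (x ≟ᵇ c)) (look-flipAt-≢ s a χ (s∉ ∘ here)))
            (hit-flipAt c A s χ (s∉ ∘ there))

one-colour : ∀ x c → ind (x ≟ᵇ c) + ind (not x ≟ᵇ c) ≡ 1
one-colour false false = refl
one-colour false true  = refl
one-colour true  false = refl
one-colour true  true  = refl

-- Each edge of A is coloured c with probability 1/2, independently of Q.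
∑-hit : ∀ {n} c (A : List (Subset n)) (Q : Col n → ℕ) → Unique A →
        (∀ {a} χ → a ∈ A → Q (flipAt a χ) ≡ Q χ) →
        2 ^ length A * ∑ (λ χ → hit c A χ * Q χ) ≤ ∑ Q
∑-hit c [] Q _ _ = ≤-reflexive (trans (*-identityˡ _) (∑-cong λ χ → *-identityˡ (Q χ)))
∑-hit c (a ∷ A) Q uniq@(_ ∷ uniqA) inv = begin
  2 * 2 ^ length A * ∑ g          ≡⟨ lemma (2 ^ length A) (∑ g) ⟩
  -- The sum over `χ` equals the sum over its flip at `a`, and exactly one of these two colourings
  -- gives `a` the colour `c`.
  2 ^ length A * (∑ g + ∑ g)      ≡⟨ cong (λ x → 2 ^ length A * (∑ g + x)) (∑-flipAt a g) ⟨
  2 ^ length A * (∑ g + ∑ (g ∘ flipAt a)) ≡⟨ cong (2 ^ length A *_) (∑-+ g (g ∘ flipAt a)) ⟨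
  2 ^ length A * ∑ (λ χ → g χ + g (flipAt a χ)) ≡⟨ cong (2 ^ length A *_) (∑-cong pointwise) ⟩
  2 ^ length A * ∑ (λ χ → hit c A χ * Q χ) ≤⟨ ∑-hit c A Q uniqA (λ χ → inv χ ∘ there) ⟩
  ∑ Q ∎
  where
  open ≤-Reasoning
  g = λ χ → hit c (a ∷ A) χ * Q χ
  lemma : ∀ x y → 2 * x * y ≡ x * (y + y)
  lemma = solve-∀
  factor : ∀ x y h q → x * h * q + y * h * q ≡ (x + y) * (h * q)
  factor = solve-∀
  pointwise : ∀ χ → g χ + g (flipAt a χ) ≡ hit c A χ * Q χ
  pointwise χ
    rewrite look-flipAt-≡ a χ | hit-flipAt c A a χ (Unique.Unique[x∷xs]⇒x∉xs uniq) | inv χ (here refl)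
    = trans (factor (ind (look χ a ≟ᵇ c)) _ (hit c A χ) (Q χ))
      (trans (cong (_* (hit c A χ * Q χ)) (one-colour (look χ a) c)) (*-identityˡ _))

-- Families forbidden inside a given set of edges.

_≟ˢ_ : ∀ {n} (s u : Subset n) → Dec (s ≡ u)
_≟ˢ_ = ≡-dec _≟ᵇ_

_∈?_ : ∀ {n} (s : Subset n) (S : List (Subset n)) → Dec (s ∈ S)
s ∈? S = Any.any? (s ≟ˢ_) S

delete : ∀ {n} → Subset n → List (Subset n) → List (Subset n)
delete s = filter (λ u → ¬? (s ≟ˢ u))

_∖_ : ∀ {n} → List (Subset n) → List (Subset n) → List (Subset n)
S ∖ []      = S
S ∖ (b ∷ B) = delete b (S ∖ B)

∖-⊆ : ∀ {n} (S B : List (Subset n)) {s} → s ∈ S ∖ B → s ∈ S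
∖-⊆ S []      s∈ = s∈
∖-⊆ S (b ∷ B) s∈ = ∖-⊆ S B (proj₁ (∈-filter⁻ (λ u → ¬? (b ≟ˢ u)) s∈))

∖-∉ : ∀ {n} (S B : List (Subset n)) {s} → s ∈ S ∖ B → s ∉ B
∖-∉ S (b ∷ B) s∈ (here refl) = proj₂ (∈-filter⁻ (λ u → ¬? (b ≟ˢ u)) {xs = S ∖ B} s∈) refl
∖-∉ S (b ∷ B) s∈ (there s∈B) = ∖-∉ S B (proj₁ (∈-filter⁻ (λ u → ¬? (b ≟ˢ u)) s∈)) s∈B

length-∖ : ∀ {n} (S B : List (Subset n)) → length (S ∖ B) ≤ length S
length-∖ S []      = ≤-refl
length-∖ S (b ∷ B) = ≤-trans (length-filter _ (S ∖ B)) (length-∖ S B)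

Mono : ∀ {n} → Col n → List (Subset n) → Set
Mono χ A = All (λ a → look χ a ≡ true) A ⊎ All (λ a → look χ a ≡ false) A

Mono-⊆ : ∀ {n} (χ : Col n) {A B} → (∀ {a} → a ∈ A → a ∈ B) → Mono χ B → Mono χ A
Mono-⊆ χ A⊆B (inj₁ h) = inj₁ (All.tabulate (All.lookup h ∘ A⊆B))
Mono-⊆ χ A⊆B (inj₂ h) = inj₂ (All.tabulate (All.lookup h ∘ A⊆B))

Mono-cong : ∀ {n} (χ χ′ : Col n) A → (∀ {a} → a ∈ A → look χ a ≡ look χ′ a) → Mono χ A → Mono χ′ A
Mono-cong χ χ′ A eq (inj₁ h) = inj₁ (All.tabulate λ a∈ → trans (sym (eq a∈)) (All.lookup h a∈))
Mono-cong χ χ′ A eq (inj₂ h) = inj₂ (All.tabulate λ a∈ → trans (sym (eq a∈)) (All.lookup h a∈))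

-- Only families lying entirely inside `S` are forbidden, so the event depends on the colours of `S`
-- alone and can only shrink as `S` grows.
Avoids : ∀ {n} → List (List (Subset n)) → List (Subset n) → Col n → Set
Avoids 𝓐 S χ = All (λ A → All (_∈ S) A → ¬ Mono χ A) 𝓐

permits? : ∀ {n} (S : List (Subset n)) (χ : Col n) A → Dec (All (_∈ S) A → ¬ Mono χ A)
permits? S χ A = All.all? (_∈? S) A →-dec ¬? (All.all? (λ a → look χ a ≟ᵇ true) A ⊎-dec
                                               All.all? (λ a → look χ a ≟ᵇ false) A)

avoids? : ∀ {n} 𝓐 (S : List (Subset n)) (χ : Col n) → Dec (Avoids 𝓐 S χ)
avoids? 𝓐 S χ = All.all? (permits? S χ) 𝓐

Avoids-antitone : ∀ {n} 𝓐 {S S′ : List (Subset n)} {χ} → (∀ {s} → s ∈ S → s ∈ S′) →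
                  Avoids 𝓐 S′ χ → Avoids 𝓐 S χ
Avoids-antitone 𝓐 S⊆S′ = All.map λ h A⊆S → h (All.map S⊆S′ A⊆S)

Avoids-cong : ∀ {n} 𝓐 {S : List (Subset n)} {χ χ′} → (∀ {s} → s ∈ S → look χ s ≡ look χ′ s) →
              Avoids 𝓐 S χ → Avoids 𝓐 S χ′
Avoids-cong 𝓐 {χ = χ} {χ′} eq = All.map λ {A} h A⊆S mono →
  h A⊆S (Mono-cong χ′ χ A (sym ∘ eq ∘ All.lookup A⊆S) mono)

-- 𝓐 may list a forbidden family in several orders; only the normalised lists
-- in through e, one per family containing e, count towards the degree D.
module LocalLemma {n : ℕ} (𝓐 : List (List (Subset n))) (through : Subset n → List (List (Subset n)))
  (b m D : ℕ) (0<b : 0 < b)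
  (nonempty : ∀ {A} → A ∈ 𝓐 → ∃ λ e → e ∈ A)
  (cover : ∀ {A e} → A ∈ 𝓐 → e ∈ A → ∃ λ B → B ∈ through e × (∀ {s} → s ∈ B → s ∈ A))
  (through-unique : ∀ {e B} → B ∈ through e → Unique B)
  (through-length : ∀ {e B} → B ∈ through e → length B ≡ m)
  (degree : ∀ e → length (through e) ≤ D)
  (loss : suc b ^ m ≤ 2 * b ^ m)
  (sparse : 4 * suc b * D ≤ 2 ^ m)
  where

  P : List (Subset n) → ℕ
  P S = ∑ (λ χ → ind (avoids? 𝓐 S χ))

  P-antitone : ∀ {S S′} → (∀ {s} → s ∈ S → s ∈ S′) → P S′ ≤ P S
  P-antitone {S} {S′} S⊆S′ =
    ∑-mono λ χ → ind-mono (avoids? 𝓐 S′ χ) (avoids? 𝓐 S χ) (Avoids-antitone 𝓐 S⊆S′)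

  P-flipAt : ∀ {S s} χ → s ∉ S → ind (avoids? 𝓐 S (flipAt s χ)) ≡ ind (avoids? 𝓐 S χ)
  P-flipAt {S} {s} χ s∉S = ≤-antisym
    (ind-mono (avoids? 𝓐 S (flipAt s χ)) (avoids? 𝓐 S χ) (Avoids-cong 𝓐 agree))
    (ind-mono (avoids? 𝓐 S χ) (avoids? 𝓐 S (flipAt s χ)) (Avoids-cong 𝓐 (sym ∘ agree)))
    where
    agree : ∀ {u} → u ∈ S → look (flipAt s χ) u ≡ look χ u
    agree {u} u∈S = look-flipAt-≢ s u χ λ { refl → s∉S u∈S }

  -- One more edge loses at most the fraction 1/(b+1) of the good colourings; the application takes
  -- b + 1 = 2m.
  Step : List (Subset n) → Set
  Step S = ∀ e → b * P S ≤ suc b * P (e ∷ S)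

  -- Counts, colour by colour, the event that `B` is monochromatic while `𝓐` is avoided inside `S`
  -- without `B`. Taking `B` out of `S` makes the second condition independent of the colours on
  -- `B`.
  bad : List (Subset n) → List (Subset n) → Col n → ℕ
  bad S B χ = hit true B χ * ind (avoids? 𝓐 (S ∖ B) χ) + hit false B χ * ind (avoids? 𝓐 (S ∖ B) χ)

  -- A colouring good for `S` but not for `e ∷ S` has a monochromatic family inside `e ∷ S`. That
  -- family contains `e`, or it would already be forbidden in `S`, and `cover` yields a
  -- monochromatic `B` in `through e` within it.
  pointwise : ∀ S e χ → ind (avoids? 𝓐 S χ) ≤
              ind (avoids? 𝓐 (e ∷ S) χ) + sum (map (λ B → bad S B χ) (through e))
  pointwise S e χ with avoids? 𝓐 S χ | avoids? 𝓐 (e ∷ S) χ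
  ... | no _   | _      = z≤n
  ... | yes _  | yes _  = s≤s z≤n
  ... | yes av | no ¬av =
    let A , A∈𝓐 , ¬h = find (¬All⇒Any¬ (permits? (e ∷ S) χ) 𝓐 ¬av) in caught A A∈𝓐 ¬h
    where
    module _ {B} (B∈ : B ∈ through e) where
      1≤ind : 1 ≤ ind (avoids? 𝓐 (S ∖ B) χ)
      1≤ind = ind-true (avoids? 𝓐 (S ∖ B) χ) (Avoids-antitone 𝓐 (∖-⊆ S B) av)
      mono⇒bad : Mono χ B → 1 ≤ bad S B χ
      mono⇒bad (inj₁ h) = ≤-trans (*-mono-≤ (hit-constant true B χ h) 1≤ind) (m≤m+n _ _)
      mono⇒bad (inj₂ h) = ≤-trans (*-mono-≤ (hit-constant false B χ h) 1≤ind)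
                                  (m≤n+m _ (hit true B χ * ind (avoids? 𝓐 (S ∖ B) χ)))
    caught : ∀ A → A ∈ 𝓐 → ¬ (All (_∈ (e ∷ S)) A → ¬ Mono χ A) →
             1 ≤ sum (map (λ B → bad S B χ) (through e))
    caught A A∈𝓐 ¬h with All.all? (_∈? (e ∷ S)) A
    ... | no A⊈  = contradiction (λ A⊆ → contradiction A⊆ A⊈) ¬h
    ... | yes A⊆ with e ∈? A
    ...   | no e∉A = ⊥-elim (¬h λ _ → All.lookup av A∈𝓐 (All.tabulate A⊆S))
      where
      A⊆S : ∀ {s} → s ∈ A → s ∈ S
      A⊆S s∈A with All.lookup A⊆ s∈A
      ... | here refl = contradiction s∈A e∉A
      ... | there s∈S = s∈S
    -- The goal is decidable, so it may be proved by contradiction; `¬h` gives monochromaticity only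
    -- under a double negation.
    ...   | yes e∈A with 1 ≤? sum (map (λ B → bad S B χ) (through e))
    ...     | yes 1≤ = 1≤
    ...     | no 1≰  = ⊥-elim (¬h λ _ mono →
      let B , B∈ , B⊆A = cover A∈𝓐 e∈A in
      1≰ (≤-trans (mono⇒bad B∈ (Mono-⊆ χ B⊆A mono)) (≤sum (λ B → bad S B χ) B∈)))

  -- If `s` is in `S`, adding it back to the shorter list restores `S` up to order, and the
  -- inductive bound applies; otherwise the deletion removes nothing.
  delete-step : ∀ S s → (s ∈ S → Step (delete s S)) → b * P (delete s S) ≤ suc b * P S
  delete-step S s step with s ∈? S
  ... | yes s∈S = ≤-trans (step s∈S s) (*-monoʳ-≤ (suc b) (P-antitone restore))
    where
    restore : ∀ {u} → u ∈ S → u ∈ s ∷ delete s S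
    restore {u} u∈S with s ≟ˢ u
    ... | yes s≡u = here (sym s≡u)
    ... | no s≢u  = there (∈-filter⁺ (λ u → ¬? (s ≟ˢ u)) u∈S s≢u)
  ... | no s∉S = *-mono-≤ (n≤1+n b) (P-antitone λ {u} u∈S →
                   ∈-filter⁺ (λ u → ¬? (s ≟ˢ u)) u∈S λ { refl → s∉S u∈S })

  -- The edges of `B` are deleted one by one, each at a cost of at most (b+1)/b.
  ∖-step : ∀ S → (∀ S′ → length S′ < length S → Step S′) →
           ∀ B → b ^ length B * P (S ∖ B) ≤ suc b ^ length B * P S
  ∖-step S step []      = ≤-refl
  ∖-step S step (s ∷ B) = begin
    b * b ^ length B * P (delete s (S ∖ B))     ≡⟨ swap b (b ^ length B) _ ⟩
    b ^ length B * (b * P (delete s (S ∖ B)))   ≤⟨ *-monoʳ-≤ (b ^ length B) (delete-step (S ∖ B) s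
         λ s∈ → step _ (<-≤-trans (filter-notAll (λ u → ¬? (s ≟ˢ u)) (S ∖ B) (Any.map (λ s≡u s≢u → s≢u s≡u) s∈)) (length-∖ S B))) ⟩
    b ^ length B * (suc b * P (S ∖ B))          ≡⟨ swap′ (suc b) (b ^ length B) _ ⟩
    suc b * (b ^ length B * P (S ∖ B))          ≤⟨ *-monoʳ-≤ (suc b) (∖-step S step B) ⟩
    suc b * (suc b ^ length B * P S)            ≡⟨ *-assoc (suc b) (suc b ^ length B) (P S) ⟨
    suc b * suc b ^ length B * P S              ∎
    where
    open ≤-Reasoning
    swap : ∀ x y z → x * y * z ≡ y * (x * z)
    swap = solve-∀
    swap′ : ∀ x y z → y * (x * z) ≡ x * (y * z)
    swap′ = solve-∀

  -- By independence each colour contributes at most 2^(-m) times the count for `S` without `B`, and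
  -- by `loss` the m deletions at most double that count.
  bad-bound : ∀ S e → (∀ S′ → length S′ < length S → Step S′) →
              ∀ {B} → B ∈ through e → 2 ^ m * ∑ (bad S B) ≤ 4 * P S
  bad-bound S e step {B} B∈ = begin
    2 ^ m * ∑ (bad S B)                     ≡⟨ cong (2 ^ m *_) (∑-+ (λ χ → hit true B χ * Q χ) (λ χ → hit false B χ * Q χ)) ⟩
    2 ^ m * (∑ (λ χ → hit true B χ * Q χ) + ∑ (λ χ → hit false B χ * Q χ)) ≡⟨ *-distribˡ-+ (2 ^ m) (∑ (λ χ → hit true B χ * Q χ)) _ ⟩
    2 ^ m * ∑ (λ χ → hit true B χ * Q χ) + 2 ^ m * ∑ (λ χ → hit false B χ * Q χ) ≤⟨ +-mono-≤ (independent true) (independent false) ⟩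
    P (S ∖ B) + P (S ∖ B)                   ≤⟨ +-mono-≤ few few ⟩
    2 * P S + 2 * P S                       ≡⟨ four (P S) ⟩
    4 * P S                                 ∎
    where
    open ≤-Reasoning
    Q = λ χ → ind (avoids? 𝓐 (S ∖ B) χ)
    four : ∀ x → 2 * x + 2 * x ≡ 4 * x
    four = solve-∀
    independent : ∀ c → 2 ^ m * ∑ (λ χ → hit c B χ * Q χ) ≤ P (S ∖ B)
    independent c = subst (λ k → 2 ^ k * ∑ (λ χ → hit c B χ * Q χ) ≤ P (S ∖ B)) (through-length B∈)
      (∑-hit c B Q (through-unique B∈) λ χ a∈B → P-flipAt χ λ a∈ → ∖-∉ S B a∈ a∈B)
    few : P (S ∖ B) ≤ 2 * P S
    few = *-cancelˡ-≤ (b ^ m) ⦃ m^n≢0 b m ⦃ >-nonZero 0<b ⦄ ⦄ (begin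
      b ^ m * P (S ∖ B)      ≤⟨ subst (λ k → b ^ k * P (S ∖ B) ≤ suc b ^ k * P S) (through-length B∈) (∖-step S step B) ⟩
      suc b ^ m * P S        ≤⟨ *-monoˡ-≤ (P S) loss ⟩
      2 * b ^ m * P S        ≡⟨ assoc-comm 2 (b ^ m) (P S) ⟩
      b ^ m * (2 * P S)      ∎)
      where
      assoc-comm : ∀ x y z → x * y * z ≡ y * (x * z)
      assoc-comm = solve-∀

  -- A union bound over `through e`: at most D * 4 * 2^(-m) * `P S` colourings are lost, which
  -- `sparse` bounds by `P S` / (b+1). Adding `P S` to both sides of the claim avoids subtraction.
  step-from-smaller : ∀ S → (∀ S′ → length S′ < length S → Step S′) → Step S
  step-from-smaller S step e = +-cancelˡ-≤ (P S) _ _ (begin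
    suc b * P S                                 ≤⟨ *-monoʳ-≤ (suc b) P-split ⟩
    suc b * (P (e ∷ S) + total)                 ≡⟨ *-distribˡ-+ (suc b) (P (e ∷ S)) total ⟩
    suc b * P (e ∷ S) + suc b * total           ≤⟨ +-monoʳ-≤ (suc b * P (e ∷ S)) total-bound ⟩
    suc b * P (e ∷ S) + P S                     ≡⟨ +-comm _ (P S) ⟩
    P S + suc b * P (e ∷ S)                     ∎)
    where
    open ≤-Reasoning
    total = sum (map (λ B → ∑ (bad S B)) (through e))
    P-split : P S ≤ P (e ∷ S) + total
    P-split = begin
      P S                  ≤⟨ ∑-mono (pointwise S e) ⟩
      ∑ (λ χ → ind (avoids? 𝓐 (e ∷ S) χ) + sum (map (λ B → bad S B χ) (through e))) ≡⟨ ∑-+ (λ χ → ind (avoids? 𝓐 (e ∷ S) χ)) (λ χ → sum (map (λ B → bad S B χ) (through e))) ⟩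
      P (e ∷ S) + ∑ (λ χ → sum (map (λ B → bad S B χ) (through e))) ≡⟨ cong (P (e ∷ S) +_) (∑-sum (bad S) (through e)) ⟩
      P (e ∷ S) + total    ∎
    rearrange : ∀ x y z → x * (y * z) ≡ y * (x * z)
    rearrange = solve-∀
    rearrange′ : ∀ x y z → y * (z * (4 * x)) ≡ 4 * y * z * x
    rearrange′ = solve-∀
    total-bound : suc b * total ≤ P S
    total-bound = *-cancelˡ-≤ (2 ^ m) ⦃ m^n≢0 2 m ⦄ (begin
      2 ^ m * (suc b * total)       ≡⟨ rearrange (2 ^ m) (suc b) total ⟩
      suc b * (2 ^ m * total)       ≤⟨ *-monoʳ-≤ (suc b) (sum-bound (2 ^ m) _ (4 * P S) (through e) (bad-bound S e step)) ⟩
      suc b * (length (through e) * (4 * P S)) ≤⟨ *-monoʳ-≤ (suc b) (*-monoˡ-≤ (4 * P S) (degree e)) ⟩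
      suc b * (D * (4 * P S))       ≡⟨ rearrange′ (P S) (suc b) D ⟩
      4 * suc b * D * P S           ≤⟨ *-monoˡ-≤ (P S) sparse ⟩
      2 ^ m * P S                   ∎)

  step-fuel : ∀ k S → length S < k → Step S
  step-fuel (suc k) S (s≤s S≤k) = step-from-smaller S λ S′ S′<S → step-fuel k S′ (<-≤-trans S′<S S≤k)

  -- For the empty list every colouring counts, because no nonempty family fits inside it; each
  -- further edge keeps a positive proportion since b > 0.
  P-positive : ∀ S → 0 < P S
  P-positive [] = ∑-positive λ χ → ind-true (avoids? 𝓐 [] χ) (All.tabulate λ A∈ A⊆[] _ →
    empty (All.lookup A⊆[] (proj₂ (nonempty A∈))))
    where
    empty : ∀ {e : Subset n} → e ∉ []
    empty ()
  P-positive (e ∷ S) = *-cancelˡ-< (suc b) 0 (P (e ∷ S)) (begin-strict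
    suc b * 0          ≡⟨ *-zeroʳ (suc b) ⟩
    0                  <⟨ *-mono-≤ 0<b (P-positive S) ⟩
    b * P S            ≤⟨ step-fuel (suc (length S)) S ≤-refl e ⟩
    suc b * P (e ∷ S)  ∎)
    where open ≤-Reasoning

  exists-avoiding : ∃ λ χ → ∀ {A} → A ∈ 𝓐 → ¬ Mono χ A
  exists-avoiding =
    -- Every member of `𝓐` lies inside `concat 𝓐`, so avoidance there is avoidance of all of `𝓐`.
    let χ , 0<ind = ∑-witness _ (P-positive (concat 𝓐))
        av        = ind-witness (avoids? 𝓐 (concat 𝓐) χ) 0<ind
    in χ , λ A∈ → All.lookup av A∈ (All.tabulate λ s∈A → ∈-concat⁺′ s∈A A∈)

-- Numerical estimates

^-distrib-* : ∀ x y k → (x * y) ^ k ≡ x ^ k * y ^ k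
^-distrib-* x y zero    = refl
^-distrib-* x y (suc k) rewrite ^-distrib-* x y k = lemma x y (x ^ k) (y ^ k)
  where
  lemma : ∀ x y u v → x * y * (u * v) ≡ x * u * (y * v)
  lemma = solve-∀

square-cancel-≤ : ∀ x y → x * x ≤ y * y → x ≤ y
square-cancel-≤ x y x²≤y² = ≮⇒≥ λ y<x → <⇒≱ (*-mono-< y<x y<x) x²≤y²

-- The left side is the first two terms of the binomial expansion of the right side.
bernoulli : ∀ u h → u ^ h * (u + suc h) ≤ suc u ^ suc h
bernoulli u zero    = ≤-reflexive (lemma u)
  where
  lemma : ∀ u → 1 * (u + 1) ≡ (1 + u) * 1
  lemma = solve-∀
bernoulli u (suc h) = begin
  u * u ^ h * (u + suc (suc h))                  ≤⟨ m≤m+n _ (u ^ h * suc h) ⟩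
  u * u ^ h * (u + suc (suc h)) + u ^ h * suc h  ≡⟨ lemma u h (u ^ h) ⟩
  suc u * (u ^ h * (u + suc h))                  ≤⟨ *-monoʳ-≤ (suc u) (bernoulli u h) ⟩
  suc u * suc u ^ suc h                          ∎
  where
  open ≤-Reasoning
  lemma : ∀ u h v → u * v * (u + (1 + (1 + h))) + v * (1 + h) ≡ (1 + u) * (v * (u + (1 + h)))
  lemma = solve-∀

-- Telescoping: (b+1)/b ≤ (c+i+1)/(c+i) whenever c + i ≤ b, and the product over i < k is (c+k)/c.
bernoulli-below : ∀ b k c → c + k ≤ suc b → suc b ^ k * c ≤ b ^ k * (c + k)
bernoulli-below b zero    c _ = ≤-reflexive (cong (1 *_) (sym (+-identityʳ c)))
bernoulli-below b (suc k) c c+k≤ = begin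
  suc b * suc b ^ k * c       ≡⟨ lemma b (suc b ^ k) c ⟩
  suc b ^ k * (b * c + c)     ≤⟨ *-monoʳ-≤ (suc b ^ k) (+-monoʳ-≤ (b * c) c≤b) ⟩
  suc b ^ k * (b * c + b)     ≡⟨ lemma′ b (suc b ^ k) c ⟩
  b * (suc b ^ k * suc c)     ≤⟨ *-monoʳ-≤ b (bernoulli-below b k (suc c) (subst (_≤ suc b) (+-suc c k) c+k≤)) ⟩
  b * (b ^ k * suc (c + k))   ≡⟨ *-assoc b (b ^ k) _ ⟨
  b * b ^ k * suc (c + k)     ≡⟨ cong (b * b ^ k *_) (+-suc c k) ⟨
  b * b ^ k * (c + suc k)     ∎
  where
  open ≤-Reasoning
  c≤b : c ≤ b
  c≤b = s≤s⁻¹ (≤-trans (≤-trans (s≤s (m≤m+n c k)) (≤-reflexive (sym (+-suc c k)))) c+k≤)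
  lemma : ∀ b x c → (1 + b) * x * c ≡ x * (b * c + c)
  lemma = solve-∀
  lemma′ : ∀ b x c → x * (b * c + b) ≡ b * (x * (1 + c))
  lemma′ = solve-∀

-- (1 + 1/j)^(j+1) decreases, cleared of denominators.
euler-step : ∀ j → suc (suc j) ^ suc (suc j) * j ^ suc j ≤ suc j ^ suc j * suc j ^ suc (suc j)
euler-step j = begin
  suc (suc j) * suc (suc j) ^ suc j * j ^ suc j   ≡⟨ *-assoc (suc (suc j)) (suc (suc j) ^ suc j) (j ^ suc j) ⟩
  suc (suc j) * (suc (suc j) ^ suc j * j ^ suc j) ≡⟨ cong (suc (suc j) *_) (^-distrib-* (suc (suc j)) j (suc j)) ⟨
  suc (suc j) * (u * u ^ j)                       ≤⟨ m≤m+n _ (u ^ j) ⟩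
  suc (suc j) * (u * u ^ j) + u ^ j               ≡⟨ lemma j (u ^ j) ⟩
  -- Bernoulli is applied at u = j(j+2), for which u + 1 = (j+1)^2.
  suc j * (u ^ j * (u + suc j))                   ≤⟨ *-monoʳ-≤ (suc j) (bernoulli u j) ⟩
  suc j * suc u ^ suc j                           ≡⟨ cong (λ x → suc j * x ^ suc j) (square j) ⟩
  suc j * (suc j * suc j) ^ suc j                 ≡⟨ cong (suc j *_) (^-distrib-* (suc j) (suc j) (suc j)) ⟩
  suc j * (suc j ^ suc j * suc j ^ suc j)         ≡⟨ lemma′ (suc j) (suc j ^ suc j) ⟩
  suc j ^ suc j * (suc j * suc j ^ suc j)         ∎
  where
  open ≤-Reasoning
  u = suc (suc j) * j
  lemma : ∀ j v → (2 + j) * ((2 + j) * j * v) + v ≡ (1 + j) * (v * ((2 + j) * j + (1 + j)))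
  lemma = solve-∀
  square : ∀ j → 1 + (2 + j) * j ≡ (1 + j) * (1 + j)
  square = solve-∀
  lemma′ : ∀ x y → x * (y * y) ≡ y * (x * y)
  lemma′ = solve-∀

-- Chains `euler-step` from n up to i + n; positivity of n allows the intermediate powers to be
-- cancelled.
euler-antitone : ∀ n i → 1 ≤ n →
  suc (i + n) ^ suc (i + n) * n ^ suc n ≤ (i + n) ^ suc (i + n) * suc n ^ suc n
euler-antitone n zero    1≤n = ≤-reflexive (*-comm (suc n ^ suc n) (n ^ suc n))
euler-antitone n (suc i) 1≤n = *-cancelˡ-≤ (j ^ suc j) ⦃ m^n≢0 j (suc j) ⦃ >-nonZero (≤-trans 1≤n (m≤n+m n i)) ⦄ ⦄ (begin
  j ^ suc j * (suc (suc j) ^ suc (suc j) * n ^ suc n)  ≡⟨ lemma (j ^ suc j) (suc (suc j) ^ suc (suc j)) (n ^ suc n) ⟩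
  suc (suc j) ^ suc (suc j) * j ^ suc j * n ^ suc n    ≤⟨ *-monoˡ-≤ (n ^ suc n) (euler-step j) ⟩
  suc j ^ suc j * suc j ^ suc (suc j) * n ^ suc n      ≡⟨ lemma′ (suc j ^ suc j) (suc j ^ suc (suc j)) (n ^ suc n) ⟩
  suc j ^ suc (suc j) * (suc j ^ suc j * n ^ suc n)    ≤⟨ *-monoʳ-≤ (suc j ^ suc (suc j)) (euler-antitone n i 1≤n) ⟩
  suc j ^ suc (suc j) * (j ^ suc j * suc n ^ suc n)    ≡⟨ lemma″ (suc j ^ suc (suc j)) (j ^ suc j) (suc n ^ suc n) ⟩
  j ^ suc j * (suc j ^ suc (suc j) * suc n ^ suc n)    ∎)
  where
  open ≤-Reasoning
  j = i + n
  lemma : ∀ x y z → x * (y * z) ≡ y * x * z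
  lemma = solve-∀
  lemma′ : ∀ x y z → x * y * z ≡ y * (x * z)
  lemma′ = solve-∀
  lemma″ : ∀ x y z → x * (y * z) ≡ y * (x * z)
  lemma″ = solve-∀

-- Stirling-type bound k! ≥ (β (k+2))^k / c for β = (n/(n+1))^(n+1) < 1/e; the
-- constant c absorbs the start of the induction at k = n.
factorial-bound : ∀ n i → 1 ≤ n → let k = i + n in
  (n ^ suc n) ^ k * (2 + k) ^ k ≤ (n ^ suc n) ^ n * (2 + n) ^ n * (k ! * (suc n ^ suc n) ^ k)
factorial-bound n zero 1≤n =
  m≤m*n _ (n ! * (suc n ^ suc n) ^ n) ⦃ m*n≢0 (n !) _ ⦃ n !≢0 ⦄ ⦃ m^n≢0 (suc n ^ suc n) n ⦃ m^n≢0 (suc n) (suc n) ⦄ ⦄ ⦄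
factorial-bound n (suc i) 1≤n = begin
  β * β ^ k * (3 + k) ^ suc k                    ≡⟨ r₁ β (β ^ k) ((3 + k) ^ suc k) ⟩
  β ^ k * ((3 + k) ^ suc k * β)                  ≤⟨ *-monoʳ-≤ (β ^ k) ratio ⟩
  β ^ k * (suc k * (2 + k) ^ k * α)              ≡⟨ r₂ (β ^ k) (suc k) ((2 + k) ^ k) α ⟩
  β ^ k * (2 + k) ^ k * (suc k * α)              ≤⟨ *-monoˡ-≤ (suc k * α) (factorial-bound n i 1≤n) ⟩
  c * (k ! * α ^ k) * (suc k * α)                ≡⟨ r₃ c (k !) (α ^ k) (suc k) α ⟩
  c * (suc k * k ! * (α * α ^ k))                ∎
  where
  open ≤-Reasoning
  k = i + n
  α = suc n ^ suc n
  β = n ^ suc n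
  c = β ^ n * (2 + n) ^ n
  r₁ : ∀ x y z → x * y * z ≡ y * (z * x)
  r₁ = solve-∀
  r₂ : ∀ x s y z → x * (s * y * z) ≡ x * y * (s * z)
  r₂ = solve-∀
  r₃ : ∀ c f y s z → c * (f * y) * (s * z) ≡ c * (s * f * (z * y))
  r₃ = solve-∀
  r₄ : ∀ s x b → s * s * (x * b) ≡ s * (s * x) * b
  r₄ = solve-∀
  r₅ : ∀ k x a → (2 + k) * ((2 + k) * ((2 + k) * x)) * a + (k * k + 3 * k + 1) * x * a ≡ (3 + k) * (3 + k) * ((1 + k) * x * a)
  r₅ = solve-∀
  -- The factor (k+3)^2 raises the exponent to k + 3, where `euler-antitone` applies between n and k
  -- + 2. What remains is (k+2)^3 ≤ (k+1)(k+3)^2, with difference k^2 + 3k + 1.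
  ratio : (3 + k) ^ suc k * β ≤ suc k * (2 + k) ^ k * α
  ratio = *-cancelˡ-≤ ((3 + k) * (3 + k)) (begin
    (3 + k) * (3 + k) * ((3 + k) ^ suc k * β)     ≡⟨ r₄ (3 + k) ((3 + k) ^ suc k) β ⟩
    (3 + k) ^ (3 + k) * β                         ≤⟨ euler-antitone n (2 + i) 1≤n ⟩
    (2 + k) ^ (3 + k) * α                         ≤⟨ m≤m+n _ ((k * k + 3 * k + 1) * (2 + k) ^ k * α) ⟩
    (2 + k) ^ (3 + k) * α + (k * k + 3 * k + 1) * (2 + k) ^ k * α ≡⟨ r₅ k ((2 + k) ^ k) α ⟩
    (3 + k) * (3 + k) * (suc k * (2 + k) ^ k * α) ∎)

-- Exponential growth against polynomial growth.

fifth-power-step : ∀ X y → 31 * X ≤ y → 1 ≤ y → X * suc y ^ 5 ≤ suc X * y ^ 5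
fifth-power-step X (suc z) 31X≤y _ = begin
  -- With y = z + 1 the increment (y+1)^5 - y^5 is at most (5+10+10+5+1) y^4 = 31 y^4; `slack` is
  -- the difference.
  X * (2 + z) ^ 5                           ≤⟨ m≤m+n _ (X * slack) ⟩
  X * (2 + z) ^ 5 + X * slack               ≡⟨ lemma X z ⟩
  X * suc z ^ 5 + 31 * X * suc z ^ 4        ≤⟨ +-monoʳ-≤ (X * suc z ^ 5) (*-monoˡ-≤ (suc z ^ 4) 31X≤y) ⟩
  X * suc z ^ 5 + suc z * suc z ^ 4         ≡⟨ +-comm _ (suc z ^ 5) ⟩
  suc X * suc z ^ 5                         ∎
  where
  open ≤-Reasoning
  slack = 26 * (z * (z * (z * z))) + 94 * (z * (z * z)) + 116 * (z * z) + 49 * z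
  lemma : ∀ X z → X * ((2 + z) * ((2 + z) * ((2 + z) * ((2 + z) * ((2 + z) * 1))))) +
      X * (26 * (z * (z * (z * z))) + 94 * (z * (z * z)) + 116 * (z * z) + 49 * z)
    ≡ X * ((1 + z) * ((1 + z) * ((1 + z) * ((1 + z) * ((1 + z) * 1))))) + 31 * X * ((1 + z) * ((1 + z) * ((1 + z) * ((1 + z) * 1))))
  lemma = solve-∀

-- From k = 31X on, the polynomial grows per step by at most the factor (X+1)/X; the constant
-- absorbs the starting value.
poly≤exp : ∀ X i → 1 ≤ X → let k₀ = 31 * X; k = i + k₀ in
  (2 + k) ^ 5 * X ^ k ≤ (2 + k₀) ^ 5 * X ^ k₀ * suc X ^ k
poly≤exp X zero    1≤X = m≤m*n _ (suc X ^ (31 * X)) ⦃ m^n≢0 (suc X) (31 * X) ⦄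
poly≤exp X (suc i) 1≤X = begin
  (3 + k) ^ 5 * (X * X ^ k)       ≡⟨ r₁ ((3 + k) ^ 5) X (X ^ k) ⟩
  X * (3 + k) ^ 5 * X ^ k         ≤⟨ *-monoˡ-≤ (X ^ k) (fifth-power-step X (2 + k) (≤-trans (m≤n+m (31 * X) i) (m≤n+m k 2)) (s≤s z≤n)) ⟩
  suc X * (2 + k) ^ 5 * X ^ k     ≡⟨ *-assoc (suc X) ((2 + k) ^ 5) (X ^ k) ⟩
  suc X * ((2 + k) ^ 5 * X ^ k)   ≤⟨ *-monoʳ-≤ (suc X) (poly≤exp X i 1≤X) ⟩
  suc X * (C * suc X ^ k)         ≡⟨ r₂ (suc X) C (suc X ^ k) ⟩
  C * (suc X * suc X ^ k)         ∎
  where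
  open ≤-Reasoning
  k = i + 31 * X
  C = (2 + 31 * X) ^ 5 * X ^ (31 * X)
  r₁ : ∀ x y z → x * (y * z) ≡ y * x * z
  r₁ = solve-∀
  r₂ : ∀ x y z → x * (y * z) ≡ y * (x * z)
  r₂ = solve-∀

-- The fifth power has one factor k + 2 to spare, which dominates the constant M * C once k ≥ M * C.
quartic-eventually≤exp : ∀ X M → 1 ≤ X → ∃ λ k₁ → ∀ k → k₁ ≤ k → M * (2 + k) ^ 4 * X ^ k ≤ suc X ^ k
quartic-eventually≤exp X M 1≤X = 31 * X + M * C , λ k k₁≤k →
  *-cancelˡ-≤ C ⦃ m*n≢0 ((2 + 31 * X) ^ 5) (X ^ (31 * X)) ⦃ _ ⦄ ⦃ m^n≢0 X (31 * X) ⦃ >-nonZero 1≤X ⦄ ⦄ ⦄ (begin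
    C * (M * (2 + k) ^ 4 * X ^ k)     ≡⟨ r C M ((2 + k) ^ 4) (X ^ k) ⟩
    M * C * (2 + k) ^ 4 * X ^ k       ≤⟨ *-monoˡ-≤ (X ^ k) (*-monoˡ-≤ ((2 + k) ^ 4)
                                          (≤-trans (≤-trans (m≤n+m (M * C) (31 * X)) k₁≤k) (m≤n+m k 2))) ⟩
    (2 + k) ^ 5 * X ^ k               ≤⟨ subst (λ k → (2 + k) ^ 5 * X ^ k ≤ C * suc X ^ k)
                                          (m∸n+n≡m (≤-trans (m≤m+n (31 * X) (M * C)) k₁≤k)) (poly≤exp X (k ∸ 31 * X) 1≤X) ⟩
    C * suc X ^ k                     ∎)
  where
  open ≤-Reasoning
  C = (2 + 31 * X) ^ 5 * X ^ (31 * X)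
  r : ∀ c m x y → c * (m * x * y) ≡ m * c * x * y
  r = solve-∀

-- The number of edges of a clique, and the sparseness condition of the local lemma.

pairCount : ℕ → ℕ
pairCount zero    = 0
pairCount (suc n) = n + pairCount n

pairCount≤ : ∀ n → pairCount n ≤ n * n
pairCount≤ zero    = z≤n
pairCount≤ (suc n) = begin
  n + pairCount n  ≤⟨ +-monoʳ-≤ n (pairCount≤ n) ⟩
  n + n * n        ≤⟨ n≤1+n _ ⟩
  suc n + n * n    ≤⟨ +-monoʳ-≤ (suc n) (*-monoʳ-≤ n (n≤1+n n)) ⟩
  suc n * suc n    ∎
  where open ≤-Reasoning

-- This is t(t-1) with t = k + 2, split as tk + t because 2^(tk) arises as the k-th power of 2^t.
double-pairCount : ∀ k → pairCount (2 + k) + pairCount (2 + k) ≡ (2 + k) * k + (2 + k)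
double-pairCount zero    = refl
double-pairCount (suc k) = begin
  (2 + k + p) + (2 + k + p)            ≡⟨ r₁ k p ⟩
  2 * (2 + k) + (p + p)                ≡⟨ cong (2 * (2 + k) +_) (double-pairCount k) ⟩
  2 * (2 + k) + ((2 + k) * k + (2 + k)) ≡⟨ r₂ k ⟩
  (3 + k) * suc k + (3 + k)            ∎
  where
  open ≡-Reasoning
  p = pairCount (2 + k)
  r₁ : ∀ k p → (2 + k + p) + (2 + k + p) ≡ 2 * (2 + k) + (p + p)
  r₁ = solve-∀
  r₂ : ∀ k → 2 * (2 + k) + ((2 + k) * k + (2 + k)) ≡ (3 + k) * (1 + k) + (3 + k)
  r₂ = solve-∀

-- The strict hypothesis says p/q < √2 (n/(n+1))^(n+1), and the last premise says N ≤ (p/q) t √2^t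
-- with t = k + 2; squares keep both integral. `L` stands for the number of k-subsets of N vertices.
local-lemma-numerics : ∀ r p q n → 1 ≤ p → 1 ≤ q → 1 ≤ n →
  p * p * (n + 1) ^ (2 * n + 2) < 2 * (q * q) * n ^ (2 * n + 2) →
  ∃ λ k₁ → ∀ k N L → k₁ ≤ k → k ! * L ≤ N ^ k →
    q * q * (N * N) ≤ p * p * ((2 + k) * (2 + k)) * 2 ^ (2 + k) →
    4 * (2 * pairCount (2 + k)) * (r * r * L) ≤ 2 ^ pairCount (2 + k)
local-lemma-numerics r p q n 1≤p 1≤q 1≤n hyp = n + k₂ , main
  where
  open ≤-Reasoning
  α = suc n ^ suc n
  β = n ^ suc n
  c = β ^ n * (2 + n) ^ n
  -- The hypothesis becomes X < Y, hence X + 1 ≤ Y, and the gap between X^k and (X+1)^k absorbs the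
  -- polynomial factor M * t^4.
  X = p * p * (α * α)
  Y = 2 * (q * q) * (β * β)
  M = 16 * (r * r) * (r * r) * (c * c)
  1≤α : 1 ≤ α
  1≤α = m^n>0 (suc n) (suc n)
  1≤X : 1 ≤ X
  1≤X = *-mono-≤ (*-mono-≤ 1≤p 1≤p) (*-mono-≤ 1≤α 1≤α)
  k₂ = proj₁ (quartic-eventually≤exp X M 1≤X)
  double : ∀ n → 2 * n + 2 ≡ suc n + suc n
  double = solve-∀
  X<Y : X < Y
  X<Y = subst₂ _<_
    (cong (p * p *_) (trans (cong₂ _^_ (+-comm n 1) (double n)) (^-distribˡ-+-* (suc n) (suc n) (suc n))))
    (cong (2 * (q * q) *_) (trans (cong (n ^_) (double n)) (^-distribˡ-+-* n (suc n) (suc n))))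
    hyp
  main : ∀ k N L → n + k₂ ≤ k → k ! * L ≤ N ^ k →
    q * q * (N * N) ≤ p * p * ((2 + k) * (2 + k)) * 2 ^ (2 + k) →
    4 * (2 * pairCount (2 + k)) * (r * r * L) ≤ 2 ^ pairCount (2 + k)
  -- Multiplying by `W` supplies the k!, q^k and β^k that the premises and the Stirling bound
  -- require; squaring turns √2^t into 2^t.
  main k N L k₁≤k k!L≤ N≤ = *-cancelʳ-≤ _ _ W ⦃ W≢0 ⦄ (square-cancel-≤ (Z * W) (2 ^ m * W) (begin
    Z * W * (Z * W)
      ≡⟨ r₁ m r L (k !) (q ^ k) (β ^ k) ⟩
    64 * (m * m) * (R * R) * (k ! * L * (k ! * L)) * (q ^ k * q ^ k) * (β ^ k * β ^ k)
      ≤⟨ *-monoˡ-≤ (β ^ k * β ^ k) (*-monoˡ-≤ (q ^ k * q ^ k) (*-monoʳ-≤ (64 * (m * m) * (R * R)) (*-mono-≤ k!L≤ k!L≤))) ⟩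
    64 * (m * m) * (R * R) * (N ^ k * N ^ k) * (q ^ k * q ^ k) * (β ^ k * β ^ k)
      ≡⟨ r₂ m R (N ^ k) (q ^ k) (β ^ k) ⟩
    64 * (m * m) * (R * R) * (q ^ k * q ^ k * (N ^ k * N ^ k)) * (β ^ k * β ^ k)
      ≡⟨ cong (λ x → 64 * (m * m) * (R * R) * x * (β ^ k * β ^ k)) qN ⟩
    64 * (m * m) * (R * R) * (q * q * (N * N)) ^ k * (β ^ k * β ^ k)
      ≤⟨ *-monoˡ-≤ (β ^ k * β ^ k) (*-monoʳ-≤ (64 * (m * m) * (R * R)) (^-monoˡ-≤ k N≤)) ⟩
    64 * (m * m) * (R * R) * (p * p * (t * t) * 2 ^ t) ^ k * (β ^ k * β ^ k)
      ≡⟨ cong (λ x → 64 * (m * m) * (R * R) * x * (β ^ k * β ^ k)) pt ⟩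
    64 * (m * m) * (R * R) * (p ^ k * p ^ k * (t ^ k * t ^ k) * 2 ^ (t * k)) * (β ^ k * β ^ k)
      ≡⟨ r₃ m R (p ^ k) (t ^ k) (2 ^ (t * k)) (β ^ k) ⟩
    64 * (m * m) * (R * R) * (p ^ k * p ^ k) * 2 ^ (t * k) * (β ^ k * t ^ k * (β ^ k * t ^ k))
      ≤⟨ *-monoʳ-≤ (64 * (m * m) * (R * R) * (p ^ k * p ^ k) * 2 ^ (t * k)) (*-mono-≤ stirling stirling) ⟩
    64 * (m * m) * (R * R) * (p ^ k * p ^ k) * 2 ^ (t * k) * (c * (k ! * α ^ k) * (c * (k ! * α ^ k)))
      ≡⟨ r₄ m R (p ^ k) (2 ^ (t * k)) c (k !) (α ^ k) ⟩
    4 * (16 * R * R * (c * c)) * (m * m) * (p ^ k * p ^ k * (α ^ k * α ^ k)) * (2 ^ (t * k) * (k ! * k !))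
      ≡⟨ cong (λ x → 4 * M * (m * m) * x * (2 ^ (t * k) * (k ! * k !))) pα ⟩
    4 * M * (m * m) * X ^ k * (2 ^ (t * k) * (k ! * k !))
      ≤⟨ *-monoˡ-≤ (2 ^ (t * k) * (k ! * k !)) exponential ⟩
    4 * Y ^ k * (2 ^ (t * k) * (k ! * k !))
      ≡⟨ cong (λ x → 4 * x * (2 ^ (t * k) * (k ! * k !))) Yk ⟩
    4 * (2 ^ k * (q ^ k * q ^ k) * (β ^ k * β ^ k)) * (2 ^ (t * k) * (k ! * k !))
      ≡⟨ r₅ (2 ^ k) (q ^ k) (β ^ k) (2 ^ (t * k)) (k !) ⟩
    2 ^ (t * k) * 2 ^ t * (W * W)
      ≡⟨ cong (_* (W * W)) (trans (sym (^-distribˡ-+-* 2 (t * k) t)) (trans (cong (2 ^_) (sym (double-pairCount k))) (^-distribˡ-+-* 2 m m))) ⟩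
    2 ^ m * 2 ^ m * (W * W)
      ≡⟨ r₆ (2 ^ m) W ⟩
    2 ^ m * W * (2 ^ m * W) ∎))
    where
    t = 2 + k
    m = pairCount t
    R = r * r
    Z = 4 * (2 * m) * (r * r * L)
    W = k ! * q ^ k * β ^ k
    instance
      _ = >-nonZero 1≤n
      _ = >-nonZero 1≤q
    W≢0 : NonZero W
    W≢0 = m*n≢0 (k ! * q ^ k) (β ^ k) ⦃ m*n≢0 (k !) (q ^ k) ⦃ k !≢0 ⦄ ⦃ m^n≢0 q k ⦄ ⦄ ⦃ m^n≢0 β k ⦃ m^n≢0 n (suc n) ⦄ ⦄
    ^-square : ∀ x → (x * x) ^ k ≡ x ^ k * x ^ k
    ^-square x = ^-distrib-* x x k
    qN : q ^ k * q ^ k * (N ^ k * N ^ k) ≡ (q * q * (N * N)) ^ k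
    qN = sym (trans (^-distrib-* (q * q) (N * N) k) (cong₂ _*_ (^-square q) (^-square N)))
    pα : p ^ k * p ^ k * (α ^ k * α ^ k) ≡ X ^ k
    pα = sym (trans (^-distrib-* (p * p) (α * α) k) (cong₂ _*_ (^-square p) (^-square α)))
    pt : (p * p * (t * t) * 2 ^ t) ^ k ≡ p ^ k * p ^ k * (t ^ k * t ^ k) * 2 ^ (t * k)
    pt = trans (^-distrib-* (p * p * (t * t)) (2 ^ t) k)
         (cong₂ _*_ (trans (^-distrib-* (p * p) (t * t) k) (cong₂ _*_ (^-square p) (^-square t)))
                    (^-*-assoc 2 t k))
    Yk : Y ^ k ≡ 2 ^ k * (q ^ k * q ^ k) * (β ^ k * β ^ k)
    Yk = trans (^-distrib-* (2 * (q * q)) (β * β) k)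
         (cong₂ _*_ (trans (^-distrib-* 2 (q * q) k) (cong (2 ^ k *_) (^-square q))) (^-square β))
    stirling : β ^ k * t ^ k ≤ c * (k ! * α ^ k)
    stirling = subst (λ k → β ^ k * (2 + k) ^ k ≤ c * (k ! * α ^ k))
                 (m∸n+n≡m (≤-trans (m≤m+n n k₂) k₁≤k)) (factorial-bound n (k ∸ n) 1≤n)
    exponential : 4 * M * (m * m) * X ^ k ≤ 4 * Y ^ k
    exponential = begin
      4 * M * (m * m) * X ^ k              ≤⟨ *-monoˡ-≤ (X ^ k) (*-monoʳ-≤ (4 * M) (*-mono-≤ (pairCount≤ t) (pairCount≤ t))) ⟩
      4 * M * (t * t * (t * t)) * X ^ k    ≡⟨ r₇ M t (X ^ k) ⟩
      4 * (M * t ^ 4 * X ^ k)              ≤⟨ *-monoʳ-≤ 4 (proj₂ (quartic-eventually≤exp X M 1≤X) k (≤-trans (m≤n+m k₂ n) k₁≤k)) ⟩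
      4 * suc X ^ k                        ≤⟨ *-monoʳ-≤ 4 (^-monoˡ-≤ k X<Y) ⟩
      4 * Y ^ k                            ∎
      where
      r₇ : ∀ a t x → 4 * a * (t * t * (t * t)) * x ≡ 4 * (a * (t * (t * (t * (t * 1)))) * x)
      r₇ = solve-∀
    r₁ : ∀ m r l f q b → 4 * (2 * m) * (r * r * l) * (f * q * b) * (4 * (2 * m) * (r * r * l) * (f * q * b))
       ≡ 64 * (m * m) * (r * r * (r * r)) * (f * l * (f * l)) * (q * q) * (b * b)
    r₁ = solve-∀
    r₂ : ∀ m r x q b → 64 * (m * m) * (r * r) * (x * x) * (q * q) * (b * b) ≡ 64 * (m * m) * (r * r) * (q * q * (x * x)) * (b * b)
    r₂ = solve-∀
    r₃ : ∀ m r p t e b → 64 * (m * m) * (r * r) * (p * p * (t * t) * e) * (b * b)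
       ≡ 64 * (m * m) * (r * r) * (p * p) * e * (b * t * (b * t))
    r₃ = solve-∀
    r₄ : ∀ m r p e c f a → 64 * (m * m) * (r * r) * (p * p) * e * (c * (f * a) * (c * (f * a)))
       ≡ 4 * (16 * r * r * (c * c)) * (m * m) * (p * p * (a * a)) * (e * (f * f))
    r₄ = solve-∀
    r₅ : ∀ x q b e f → 4 * (x * (q * q) * (b * b)) * (e * (f * f)) ≡ e * (2 * (2 * x)) * (f * q * b * (f * q * b))
    r₅ = solve-∀
    r₆ : ∀ x w → x * x * (w * w) ≡ x * w * (x * w)
    r₆ = solve-∀

-- Copies of suspensions

length-cartesianProduct : ∀ {A B : Set} (xs : List A) (ys : List B) →
                          length (cartesianProduct xs ys) ≡ length xs * length ys
length-cartesianProduct []       ys = refl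
length-cartesianProduct (x ∷ xs) ys =
  trans (length-++ (map (x ,_) ys)) (cong₂ _+_ (length-map (x ,_) ys) (length-cartesianProduct xs ys))

unique-⊆-length : ∀ {A : Set} {xs ys : List A} → Unique xs → (∀ {x} → x ∈ xs → x ∈ ys) →
                  length xs ≤ length ys
unique-⊆-length []             _     = z≤n
unique-⊆-length {xs = x ∷ xs} uniq@(_ ∷ uniqxs) xs⊆ys with ∈-∃++ (xs⊆ys (here refl))
... | as , bs , refl = begin
  suc (length xs)               ≤⟨ s≤s (unique-⊆-length uniqxs remaining) ⟩
  suc (length (as ++ bs))       ≡⟨ cong suc (length-++ as) ⟩
  suc (length as + length bs)   ≡⟨ +-suc (length as) (length bs) ⟨
  length as + suc (length bs)   ≡⟨ length-++ as ⟨
  length (as ++ x ∷ bs)         ∎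
  where
  open ≤-Reasoning
  remaining : ∀ {z} → z ∈ xs → z ∈ as ++ bs
  remaining z∈xs with ∈-++⁻ as (xs⊆ys (there z∈xs))
  ... | inj₁ z∈as         = ∈-++⁺ˡ z∈as
  ... | inj₂ (here refl)  = contradiction z∈xs (Unique.Unique[x∷xs]⇒x∉xs uniq)
  ... | inj₂ (there z∈bs) = ∈-++⁺ʳ as z∈bs

-- Sublists of a given length and normal forms of vertex sets.

combinations : ∀ {A : Set} → ℕ → List A → List (List A)
combinations zero    xs       = [] ∷ []
combinations (suc k) []       = []
combinations (suc k) (x ∷ xs) = map (x ∷_) (combinations k xs) ++ combinations (suc k) xs

filter∈combinations : ∀ {A : Set} {P : A → Set} (P? : ∀ x → Dec (P x)) xs →
                      filter P? xs ∈ combinations (length (filter P? xs)) xs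
filter∈combinations P? [] = here refl
filter∈combinations P? (x ∷ xs) with P? x
... | yes _ = ∈-++⁺ˡ (∈-map⁺ (x ∷_) (filter∈combinations P? xs))
... | no _  = weaken (filter P? xs) (filter∈combinations P? xs)
  where
  weaken : ∀ zs → zs ∈ combinations (length zs) xs → zs ∈ combinations (length zs) (x ∷ xs)
  weaken []       _  = here refl
  weaken (z ∷ zs) z∈ = ∈-++⁺ʳ (map (x ∷_) (combinations (length zs) xs)) z∈

-- Pascal's rule reduces the bound to (k+1) l^k + l^(k+1) ≤ (l+1)^(k+1), which is Bernoulli.
length-combinations : ∀ {A : Set} k (xs : List A) → k ! * length (combinations k xs) ≤ length xs ^ k
length-combinations zero    xs       = ≤-refl
length-combinations (suc k) []       = ≤-reflexive (*-zeroʳ (suc k !))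
length-combinations (suc k) (x ∷ xs) = begin
  suc k ! * length (combinations (suc k) (x ∷ xs))
    ≡⟨ cong (suc k ! *_) (trans (length-++ (map (x ∷_) (combinations k xs)))
         (cong (_+ length (combinations (suc k) xs)) (length-map (x ∷_) (combinations k xs)))) ⟩
  suc k * k ! * (c + length (combinations (suc k) xs))
    ≡⟨ r₁ (suc k) (k !) c _ ⟩
  suc k * (k ! * c) + suc k ! * length (combinations (suc k) xs)
    ≤⟨ +-mono-≤ (*-monoʳ-≤ (suc k) (length-combinations k xs)) (length-combinations (suc k) xs) ⟩
  suc k * l ^ k + l * l ^ k
    ≡⟨ r₂ (suc k) l (l ^ k) ⟩
  l ^ k * (l + suc k)
    ≤⟨ bernoulli l k ⟩
  suc l ^ suc k ∎
  where
  open ≤-Reasoning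
  l = length xs
  c = length (combinations k xs)
  r₁ : ∀ s f c d → s * f * (c + d) ≡ s * (f * c) + s * f * d
  r₁ = solve-∀
  r₂ : ∀ s l e → s * e + l * e ≡ e * (l + s)
  r₂ = solve-∀

_∈ᶠ?_ : ∀ {N} (x : Fin N) xs → Dec (x ∈ xs)
x ∈ᶠ? xs = Any.any? (x ≟ᶠ_) xs

-- Normal form of a vertex set, increasing and without repetition, so that it occurs among the
-- `combinations` of `allFin`.
sort : ∀ {N} → List (Fin N) → List (Fin N)
sort xs = filter (_∈ᶠ? xs) (allFin _)

∈-sort⁺ : ∀ {N} {xs : List (Fin N)} {x} → x ∈ xs → x ∈ sort xs
∈-sort⁺ {xs = xs} x∈xs = ∈-filter⁺ (_∈ᶠ? xs) (∈-allFin _) x∈xs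

∈-sort⁻ : ∀ {N} {xs : List (Fin N)} {x} → x ∈ sort xs → x ∈ xs
∈-sort⁻ {N} {xs} x∈ = proj₂ (∈-filter⁻ (_∈ᶠ? xs) {xs = allFin N} x∈)

sort-unique : ∀ {N} (xs : List (Fin N)) → Unique (sort xs)
sort-unique {N} xs = Unique.filter⁺ (_∈ᶠ? xs) (Unique.allFin⁺ N)

length-sort : ∀ {N} {xs : List (Fin N)} → Unique xs → length (sort xs) ≡ length xs
length-sort {xs = xs} uniq =
  ≤-antisym (unique-⊆-length (sort-unique xs) ∈-sort⁻) (unique-⊆-length uniq ∈-sort⁺)

sort∈combinations : ∀ {N} {xs : List (Fin N)} {k} → Unique xs → length xs ≡ k →
                    sort xs ∈ combinations k (allFin N)
sort∈combinations {N} {xs} uniq refl =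
  subst (λ k → sort xs ∈ combinations k (allFin N)) (length-sort uniq) (filter∈combinations (_∈ᶠ? xs) (allFin N))

elements : ∀ {N} → Subset N → List (Fin N)
elements s = filter (_∈ˢ? s) (allFin _)

∈-elements⁺ : ∀ {N} {s : Subset N} {x} → x ∈ˢ s → x ∈ elements s
∈-elements⁺ {s = s} x∈s = ∈-filter⁺ (_∈ˢ? s) (∈-allFin _) x∈s

∈-elements⁻ : ∀ {N} {s : Subset N} {x} → x ∈ elements s → x ∈ˢ s
∈-elements⁻ {N} {s} x∈ = proj₂ (∈-filter⁻ (_∈ˢ? s) {xs = allFin N} x∈)

elements-unique : ∀ {N} (s : Subset N) → Unique (elements s)
elements-unique {N} s = Unique.filter⁺ (_∈ˢ? s) (Unique.allFin⁺ N)

subsets : ∀ n → List (Subset n)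
subsets zero    = [] ∷ []
subsets (suc n) = map (false ∷_) (subsets n) ++ map (true ∷_) (subsets n)

∈-subsets : ∀ {n} (s : Subset n) → s ∈ subsets n
∈-subsets []              = here refl
∈-subsets (false ∷ s)     = ∈-++⁺ˡ (∈-map⁺ (false ∷_) (∈-subsets s))
∈-subsets {suc n} (true ∷ s) = ∈-++⁺ʳ (map (false ∷_) (subsets n)) (∈-map⁺ (true ∷_) (∈-subsets s))

x∉p─q : ∀ {n} {p q : Subset n} {x} → x ∈ˢ p ─ q → x ∉ˢ q
x∉p─q {p = _ ∷ p} {outside ∷ q} (there x∈) (there x∈q) = x∉p─q x∈ x∈q
x∉p─q {p = _ ∷ p} {inside ∷ q}  (there x∈) (there x∈q) = x∉p─q x∈ x∈q

-- Edges of a suspension.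

join-edge : ∀ {N} → Subset N → Fin N → Fin N → Subset N
join-edge U x y = ⁅ x ⁆ ∪ (⁅ y ⁆ ∪ U)

module _ {N : ℕ} {U : Subset N} where

  ∈-join-edge⁻ : ∀ {x y z} → z ∈ˢ join-edge U x y → z ≡ x ⊎ z ≡ y ⊎ z ∈ˢ U
  ∈-join-edge⁻ {x} {y} z∈ = Sum.map (x∈⁅y⁆⇒x≡y x) (Sum.map₁ (x∈⁅y⁆⇒x≡y y) ∘ x∈p∪q⁻ ⁅ y ⁆ U)
                              (x∈p∪q⁻ ⁅ x ⁆ (⁅ y ⁆ ∪ U) z∈)

  x∈join-edge : ∀ {x y} → x ∈ˢ join-edge U x y
  x∈join-edge {x} = x∈p∪q⁺ (inj₁ (x∈⁅x⁆ x))

  y∈join-edge : ∀ {x y} → y ∈ˢ join-edge U x y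
  y∈join-edge {x} {y} = x∈p∪q⁺ {p = ⁅ x ⁆} (inj₂ (x∈p∪q⁺ (inj₁ (x∈⁅x⁆ y))))

  U⊆join-edge : ∀ {x y z} → z ∈ˢ U → z ∈ˢ join-edge U x y
  U⊆join-edge {x} {y} z∈U = x∈p∪q⁺ {p = ⁅ x ⁆} (inj₂ (x∈p∪q⁺ {p = ⁅ y ⁆} (inj₂ z∈U)))

  join-edge-comm : ∀ x y → join-edge U x y ≡ join-edge U y x
  join-edge-comm x y = ⊆-antisym (swap⊆ x y) (swap⊆ y x)
    where
    swap⊆ : ∀ x y {z} → z ∈ˢ join-edge U x y → z ∈ˢ join-edge U y x
    swap⊆ x y z∈ with ∈-join-edge⁻ {x} {y} z∈
    ... | inj₁ refl        = y∈join-edge {y} {x}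
    ... | inj₂ (inj₁ refl) = x∈join-edge {y} {x}
    ... | inj₂ (inj₂ z∈U)  = U⊆join-edge {y} {x} z∈U

  join-edge-remove : ∀ {x y} → x ∉ˢ U → y ∉ˢ U → join-edge U x y - x - y ≡ U
  join-edge-remove {x} {y} x∉U y∉U = ⊆-antisym there′ back
    where
    there′ : ∀ {z} → z ∈ˢ join-edge U x y - x - y → z ∈ˢ U
    there′ {z} z∈ with ∈-join-edge⁻ {x} {y} (p─q⊆p _ ⁅ x ⁆ (p─q⊆p (join-edge U x y - x) ⁅ y ⁆ z∈))
    ... | inj₁ refl        = contradiction (x∈⁅x⁆ x) (x∉p─q (p─q⊆p (join-edge U x y - x) ⁅ y ⁆ z∈))
    ... | inj₂ (inj₁ refl) = contradiction (x∈⁅x⁆ y) (x∉p─q {p = join-edge U x y - x} z∈)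
    ... | inj₂ (inj₂ z∈U)  = z∈U
    back : ∀ {z} → z ∈ˢ U → z ∈ˢ join-edge U x y - x - y
    back z∈U = x∈p∧x≢y⇒x∈p-y (x∈p∧x≢y⇒x∈p-y (U⊆join-edge {x} {y} z∈U) λ { refl → x∉U z∈U }) λ { refl → y∉U z∈U }

  length-elements-join-edge : ∀ x y → length (elements (join-edge U x y)) ≤ 2 + length (elements U)
  length-elements-join-edge x y = unique-⊆-length (elements-unique (join-edge U x y)) into
    where
    into : ∀ {z} → z ∈ elements (join-edge U x y) → z ∈ x ∷ y ∷ elements U
    into z∈ with ∈-join-edge⁻ {x} {y} (∈-elements⁻ z∈)
    ... | inj₁ refl        = here refl
    ... | inj₂ (inj₁ refl) = there (here refl)
    ... | inj₂ (inj₂ z∈U)  = there (there (∈-elements⁺ z∈U))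

-- The edges of the copy of SK_t with clique T and apex set U.
suspension : ∀ {N} → Subset N → List (Fin N) → List (Subset N)
suspension U []      = []
suspension U (x ∷ T) = map (join-edge U x) T ++ suspension U T

module _ {N : ℕ} {U : Subset N} where

  length-suspension : ∀ T → length (suspension U T) ≡ pairCount (length T)
  length-suspension []      = refl
  length-suspension (x ∷ T) = trans (length-++ (map (join-edge U x) T))
    (cong₂ _+_ (length-map (join-edge U x) T) (length-suspension T))

  ∈-suspension⁻ : ∀ {T e} → Unique T → e ∈ suspension U T →
                  ∃ λ x → ∃ λ y → x ∈ T × y ∈ T × x ≢ y × e ≡ join-edge U x y
  ∈-suspension⁻ {x ∷ T} uniq@(_ ∷ uniqT) e∈ with ∈-++⁻ (map (join-edge U x) T) e∈
  ... | inj₁ e∈map = let y , y∈T , eq = ∈-map⁻ (join-edge U x) e∈map in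
    x , y , here refl , there y∈T , (λ x≡y → Unique.Unique[x∷xs]⇒x∉xs uniq (subst (_∈ T) (sym x≡y) y∈T)) , eq
  ... | inj₂ e∈rest = let x , y , x∈T , y∈T , x≢y , eq = ∈-suspension⁻ uniqT e∈rest in
    x , y , there x∈T , there y∈T , x≢y , eq

  ∈-suspension⁺ : ∀ {T x y} → x ∈ T → y ∈ T → x ≢ y → join-edge U x y ∈ suspension U T
  ∈-suspension⁺ (here refl) (here refl) x≢y = contradiction refl x≢y
  ∈-suspension⁺ {_ ∷ T} {x} (here refl) (there y∈T) x≢y = ∈-++⁺ˡ (∈-map⁺ (join-edge U x) y∈T)
  ∈-suspension⁺ {_ ∷ T} {x} {y} (there x∈T) (here refl) x≢y =
    subst (_∈ suspension U (y ∷ T)) (join-edge-comm y x) (∈-++⁺ˡ (∈-map⁺ (join-edge U y) x∈T))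
  ∈-suspension⁺ {z ∷ T} (there x∈T) (there y∈T) x≢y =
    ∈-++⁺ʳ (map (join-edge U z) T) (∈-suspension⁺ x∈T y∈T x≢y)

  suspension-mono : ∀ {T T′ e} → Unique T → (∀ {x} → x ∈ T → x ∈ T′) → e ∈ suspension U T → e ∈ suspension U T′
  suspension-mono uniq T⊆T′ e∈ with ∈-suspension⁻ uniq e∈
  ... | x , y , x∈T , y∈T , x≢y , refl = ∈-suspension⁺ (T⊆T′ x∈T) (T⊆T′ y∈T) x≢y

  -- The endpoint y can be read off from the edge, since it differs from x and lies outside `U`.
  join-edges-unique : ∀ {x} T → Unique T → x ∉ T → All (_∉ˢ U) T → Unique (map (join-edge U x) T)
  join-edges-unique     []      _ _ _ = []
  join-edges-unique {x} (y ∷ T) uniq@(_ ∷ uniqT) x∉ (y∉U ∷ T∉U) =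
    All.tabulate distinct ∷ join-edges-unique T uniqT (x∉ ∘ there) T∉U
    where
    distinct : ∀ {e} → e ∈ map (join-edge U x) T → join-edge U x y ≢ e
    distinct e∈ eq with ∈-map⁻ (join-edge U x) e∈
    ... | z , z∈T , refl with ∈-join-edge⁻ {U = U} {x} {z} (subst (y ∈ˢ_) eq (y∈join-edge {U = U} {x} {y}))
    ...   | inj₁ refl        = x∉ (here refl)
    ...   | inj₂ (inj₁ refl) = Unique.Unique[x∷xs]⇒x∉xs uniq z∈T
    ...   | inj₂ (inj₂ y∈U)  = y∉U y∈U

  -- The edges at the head x contain x, whereas those of the remaining clique do not, as x is
  -- neither in `T` nor in `U`.
  suspension-unique : ∀ {T} → Unique T → All (_∉ˢ U) T → Unique (suspension U T)
  suspension-unique {[]}    _ _ = []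
  suspension-unique {x ∷ T} uniq@(_ ∷ uniqT) (x∉U ∷ T∉U) =
    Unique.++⁺ (join-edges-unique T uniqT (Unique.Unique[x∷xs]⇒x∉xs uniq) T∉U) (suspension-unique uniqT T∉U) disjoint
    where
    disjoint : ∀ {e} → e ∈ map (join-edge U x) T × e ∈ suspension U T → ⊥₀
    disjoint (e∈map , e∈) with ∈-map⁻ (join-edge U x) e∈map | ∈-suspension⁻ uniqT e∈
    ... | y , _ , refl | v , w , v∈T , w∈T , _ , eq
      with ∈-join-edge⁻ {U = U} {v} {w} (subst (x ∈ˢ_) eq (x∈join-edge {U = U} {x} {y}))
    ... | inj₁ refl        = Unique.Unique[x∷xs]⇒x∉xs uniq v∈T
    ... | inj₂ (inj₁ refl) = Unique.Unique[x∷xs]⇒x∉xs uniq w∈T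
    ... | inj₂ (inj₂ x∈U)  = x∉U x∈U

-- The family of all copies and its degree.

module Copies (N u k : ℕ) where

  -- In the application u = r - 2 and k = t - 2, with `U` the apex set and `T` the clique. The bound
  -- on `U` limits every edge to u + 2 vertices.
  Proper : Subset N × List (Fin N) → Set
  Proper (U , T) = length (elements U) ≤ u × Unique T × All (_∉ˢ U) T × length T ≡ 2 + k

  proper? : ∀ UT → Dec (Proper UT)
  proper? (U , T) = (length (elements U) ≤? u) ×-dec UniqueDec.unique? _≟ᶠ_ T
                    ×-dec All.all? (λ x → ¬? (x ∈ˢ? U)) T ×-dec (length T ≟ 2 + k)

  edges : Subset N × List (Fin N) → List (Subset N)
  edges (U , T) = suspension U T

  candidates : List (Subset N × List (Fin N))
  candidates = cartesianProduct (subsets N) (combinations (2 + k) (allFin N))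

  copies : List (List (Subset N))
  copies = map edges (filter proper? candidates)

  ∈-copies⁻ : ∀ {A} → A ∈ copies → ∃ λ UT → Proper UT × A ≡ edges UT
  ∈-copies⁻ A∈ =
    let UT , UT∈ , eq = ∈-map⁻ edges A∈
    in UT , proj₂ (∈-filter⁻ proper? {xs = candidates} UT∈) , eq

  copy∈copies : ∀ {U T} → Proper (U , T) → edges (U , sort T) ∈ copies
  copy∈copies {U} {T} (U≤u , uniq , T∉U , len) = ∈-map⁺ edges (∈-filter⁺ proper?
    (∈-cartesianProduct⁺ (∈-subsets U) (sort∈combinations uniq len))
    (U≤u , sort-unique T , All.tabulate (All.lookup T∉U ∘ ∈-sort⁻) , trans (length-sort uniq) len))

  -- x and y play the part of the clique edge, so e determines U = e - x - y.
  rebuild : Subset N → (Fin N × Fin N) × List (Fin N) → Subset N × List (Fin N)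
  rebuild e ((x , y) , T) = e - x - y , x ∷ y ∷ T

  extensions : Subset N → List (Subset N × List (Fin N))
  extensions e = map (rebuild e)
    (cartesianProduct (cartesianProduct (elements e) (elements e)) (combinations k (allFin N)))

  through : Subset N → List (List (Subset N))
  through e with length (elements e) ≤? 2 + u
  ... | yes _ = map edges (filter proper? (extensions e))
  -- A set with more than u + 2 elements lies in no copy; the empty list keeps the degree bound
  -- valid for every `e`.
  ... | no _  = []

  through-proper : ∀ {e B} → B ∈ through e → ∃ λ UT → Proper UT × B ≡ edges UT
  through-proper {e} B∈ with length (elements e) ≤? 2 + u
  ... | yes _ =
    let UT , UT∈ , eq = ∈-map⁻ edges B∈
    in UT , proj₂ (∈-filter⁻ proper? {xs = extensions e} UT∈) , eq

  through-unique : ∀ {e B} → B ∈ through e → Unique B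
  through-unique B∈ with through-proper B∈
  ... | _ , (_ , uniq , T∉U , _) , refl = suspension-unique uniq T∉U

  through-length : ∀ {e B} → B ∈ through e → length B ≡ pairCount (2 + k)
  through-length B∈ with through-proper B∈
  ... | (_ , T) , (_ , _ , _ , len) , refl = trans (length-suspension T) (cong pairCount len)

  -- There are at most (u+2)^2 ordered choices of the clique edge within `e`, times the choices of
  -- the other k clique vertices.
  degree : ∀ e → length (through e) ≤ (2 + u) * (2 + u) * length (combinations k (allFin N))
  degree e with length (elements e) ≤? 2 + u
  ... | no _  = z≤n
  ... | yes e≤ = begin
    length (map edges (filter proper? (extensions e)))  ≡⟨ length-map edges (filter proper? (extensions e)) ⟩
    length (filter proper? (extensions e))              ≤⟨ length-filter proper? (extensions e) ⟩
    length (extensions e)                               ≡⟨ length-map (rebuild e) (cartesianProduct (cartesianProduct es es) cs) ⟩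
    length (cartesianProduct (cartesianProduct es es) cs) ≡⟨ length-cartesianProduct (cartesianProduct es es) cs ⟩
    length (cartesianProduct es es) * length cs         ≡⟨ cong (_* length cs) (length-cartesianProduct es es) ⟩
    length es * length es * length cs                   ≤⟨ *-monoˡ-≤ (length cs) (*-mono-≤ e≤ e≤) ⟩
    (2 + u) * (2 + u) * length cs                       ∎
    where
    open ≤-Reasoning
    es = elements e
    cs = combinations k (allFin N)

  nonempty : ∀ {A} → A ∈ copies → ∃ λ e → e ∈ A
  nonempty A∈ with ∈-copies⁻ A∈
  ... | (U , x ∷ y ∷ T) , _ , refl = join-edge U x y , here refl

  ∈-through : ∀ {U T x y} → Proper (U , x ∷ y ∷ T) → T ∈ combinations k (allFin N) →
              suspension U (x ∷ y ∷ T) ∈ through (join-edge U x y)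
  ∈-through {U} {T} {x} {y} proper@(U≤u , _ , x∉U ∷ y∉U ∷ _ , _) T∈
    with length (elements (join-edge U x y)) ≤? 2 + u
  ... | no e≰ = contradiction (≤-trans (length-elements-join-edge x y) (+-monoʳ-≤ 2 U≤u)) e≰
  ... | yes _ = ∈-map⁺ edges (∈-filter⁺ proper? (subst (_∈ extensions e) rebuild≡
      (∈-map⁺ (rebuild e) (∈-cartesianProduct⁺ (∈-cartesianProduct⁺
        (∈-elements⁺ (x∈join-edge {U = U} {x} {y})) (∈-elements⁺ (y∈join-edge {U = U} {x} {y}))) T∈))) proper)
    where
    e = join-edge U x y
    rebuild≡ : rebuild e ((x , y) , T) ≡ (U , x ∷ y ∷ T)
    rebuild≡ = cong (_, x ∷ y ∷ T) (join-edge-remove x∉U y∉U)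

  -- The clique is relisted with the endpoints of `e` first and the others sorted behind them; the
  -- vertex set, hence the set of edges, stays the same.
  cover : ∀ {A e} → A ∈ copies → e ∈ A → ∃ λ B → B ∈ through e × (∀ {s} → s ∈ B → s ∈ A)
  cover A∈ e∈A with ∈-copies⁻ A∈
  ... | (U , T) , (U≤u , uniq , T∉U , len) , refl with ∈-suspension⁻ uniq e∈A
  ...   | x , y , x∈T , y∈T , x≢y , refl =
    suspension U T′ , ∈-through (U≤u , uniq′ , All.tabulate (All.lookup T∉U ∘ T′⊆T) , len′) S∈ , suspension-mono uniq′ T′⊆T
    where
    other? : ∀ z → Dec (z ≢ x × z ≢ y)
    other? z = ¬? (z ≟ᶠ x) ×-dec ¬? (z ≟ᶠ y)
    rest = filter other? T
    rest-unique : Unique rest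
    rest-unique = Unique.filter⁺ other? uniq
    S = sort rest
    T′ = x ∷ y ∷ S
    S⁻ : ∀ {z} → z ∈ S → z ∈ T × z ≢ x × z ≢ y
    S⁻ z∈S = ∈-filter⁻ other? (∈-sort⁻ z∈S)
    T′⊆T : ∀ {z} → z ∈ T′ → z ∈ T
    T′⊆T (here refl)         = x∈T
    T′⊆T (there (here refl)) = y∈T
    T′⊆T (there (there z∈S)) = proj₁ (S⁻ z∈S)
    T⊆T′ : ∀ {z} → z ∈ T → z ∈ T′
    T⊆T′ {z} z∈T with z ≟ᶠ x | z ≟ᶠ y
    ... | yes refl | _        = here refl
    ... | no _     | yes refl = there (here refl)
    ... | no z≢x   | no z≢y   = there (there (∈-sort⁺ (∈-filter⁺ other? z∈T (z≢x , z≢y))))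
    uniq′ : Unique T′
    uniq′ = (x≢y ∷ All.tabulate λ z∈S x≡z → proj₁ (proj₂ (S⁻ z∈S)) (sym x≡z))
          ∷ (All.tabulate λ z∈S y≡z → proj₂ (proj₂ (S⁻ z∈S)) (sym y≡z))
          ∷ sort-unique rest
    len′ : length T′ ≡ 2 + k
    len′ = trans (≤-antisym (unique-⊆-length uniq′ T′⊆T) (unique-⊆-length uniq T⊆T′)) len
    S∈ : S ∈ combinations k (allFin N)
    S∈ = sort∈combinations rest-unique
           (trans (sym (length-sort rest-unique)) (suc-injective (suc-injective len′)))

-- Images of hyperedges under an embedding.

∈-⋃⁺ : ∀ {n x} {p : Subset n} {ps} → p ∈ ps → x ∈ˢ p → x ∈ˢ ⋃ ps
∈-⋃⁺ (here refl)             x∈p = x∈p∪q⁺ (inj₁ x∈p)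
∈-⋃⁺ {ps = q ∷ _} (there p∈) x∈p = x∈p∪q⁺ {p = q} (inj₂ (∈-⋃⁺ p∈ x∈p))

∈-⋃⁻ : ∀ {n x} (ps : List (Subset n)) → x ∈ˢ ⋃ ps → ∃ λ p → p ∈ ps × x ∈ˢ p
∈-⋃⁻ []       x∈ = contradiction x∈ ∉⊥
∈-⋃⁻ (p ∷ ps) x∈ with x∈p∪q⁻ p (⋃ ps) x∈
... | inj₁ x∈p = p , here refl , x∈p
... | inj₂ x∈ps = let q , q∈ , x∈q = ∈-⋃⁻ ps x∈ps in q , there q∈ , x∈q

module _ {m n : ℕ} (φ : Fin m → Fin n) (e : Subset m) where

  private
    piece : Fin m → Subset n
    piece x = if lookup e x then ⁅ φ x ⁆ else ⊥

  ∈-image⁺ : ∀ {i} → i ∈ˢ e → φ i ∈ˢ image φ e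
  ∈-image⁺ {i} i∈e = ∈-⋃⁺ (∈-map⁺ piece (∈-allFin i))
    (subst (λ b → φ i ∈ˢ (if b then ⁅ φ i ⁆ else ⊥)) (sym ([]=⇒lookup i∈e)) (x∈⁅x⁆ (φ i)))

  ∈-image⁻ : ∀ {x} → x ∈ˢ image φ e → ∃ λ i → i ∈ˢ e × x ≡ φ i
  ∈-image⁻ {x} x∈ with ∈-⋃⁻ (map piece (allFin m)) x∈
  ... | p , p∈ , x∈p with ∈-map⁻ piece p∈
  ...   | i , _ , refl with lookup e i in eq
  ...     | true  = i , lookup⇒[]= i e eq , x∈⁅y⁆⇒x≡y (φ i) x∈p
  ...     | false = contradiction x∈p ∉⊥

∈ˢ-++⁺ˡ : ∀ {m n} {p : Subset m} {q : Subset n} {i} → i ∈ˢ p → i ↑ˡ n ∈ˢ p Vec.++ q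
∈ˢ-++⁺ˡ here       = here
∈ˢ-++⁺ˡ (there i∈) = there (∈ˢ-++⁺ˡ i∈)

∈ˢ-++⁺ʳ : ∀ {m n} (p : Subset m) {q : Subset n} {i} → i ∈ˢ q → m ↑ʳ i ∈ˢ p Vec.++ q
∈ˢ-++⁺ʳ []      i∈ = i∈
∈ˢ-++⁺ʳ (_ ∷ p) i∈ = there (∈ˢ-++⁺ʳ p i∈)

∈ˢ-++⁻ : ∀ {m n} (p : Subset m) {q : Subset n} {i} → i ∈ˢ p Vec.++ q →
         (∃ λ j → j ∈ˢ p × i ≡ j ↑ˡ n) ⊎ (∃ λ j → j ∈ˢ q × i ≡ m ↑ʳ j)
∈ˢ-++⁻ []      i∈         = inj₂ (_ , i∈ , refl)
∈ˢ-++⁻ (_ ∷ p) here       = inj₁ (zero , here , refl)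
∈ˢ-++⁻ (_ ∷ p) (there i∈) with ∈ˢ-++⁻ p i∈
... | inj₁ (j , j∈ , refl) = inj₁ (suc j , there j∈ , refl)
... | inj₂ (j , j∈ , refl) = inj₂ (j , j∈ , refl)

↑ˡ≢↑ʳ : ∀ {m n} (i : Fin m) (j : Fin n) → i ↑ˡ n ≢ m ↑ʳ j
↑ˡ≢↑ʳ {m} {n} i j eq with trans (sym (splitAt-↑ˡ m i n)) (trans (cong (splitAt m) eq) (splitAt-↑ʳ m n j))
... | ()

∣pair∣≡2 : ∀ {n} {i j : Fin n} → i ≢ j → ∣ ⁅ i ⁆ ∪ ⁅ j ⁆ ∣ ≡ 2
∣pair∣≡2 {i = zero}  {zero}  i≢j = contradiction refl i≢j
∣pair∣≡2 {i = zero}  {suc j} i≢j = cong suc (trans (cong ∣_∣ (∪-identityˡ ⁅ j ⁆)) (∣⁅x⁆∣≡1 j))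
∣pair∣≡2 {i = suc i} {zero}  i≢j = cong suc (trans (cong ∣_∣ (∪-identityʳ ⁅ i ⁆)) (∣⁅x⁆∣≡1 i))
∣pair∣≡2 {i = suc i} {suc j} i≢j = ∣pair∣≡2 (i≢j ∘ cong suc)

module _ {N : ℕ} (t u : ℕ) (φ : Fin (t + u) → Fin N) where

  apex : Subset N
  apex = image φ (⊥ {t} Vec.++ ⊤ {u})

  base : List (Fin N)
  base = tabulate (λ i → φ (i ↑ˡ u))

  apex⁻ : ∀ {x} → x ∈ˢ apex → ∃ λ j → x ≡ φ (t ↑ʳ j)
  apex⁻ x∈ with ∈-image⁻ φ (⊥ {t} Vec.++ ⊤) x∈
  ... | i , i∈ , refl with ∈ˢ-++⁻ (⊥ {t}) i∈
  ...   | inj₁ (_ , j∈ , _)    = contradiction j∈ ∉⊥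
  ...   | inj₂ (j , _ , refl) = j , refl

  base⁻ : ∀ {x} → x ∈ base → ∃ λ i → x ≡ φ (i ↑ˡ u)
  base⁻ = ∈-tabulate⁻ {f = λ i → φ (i ↑ˡ u)}

  -- Translates between the hyperedges of the abstract suspension and the explicit edges listed by
  -- `suspension`.
  image-edge : ∀ i j → image φ ((⁅ i ⁆ ∪ ⁅ j ⁆) Vec.++ ⊤ {u}) ≡ join-edge apex (φ (i ↑ˡ u)) (φ (j ↑ˡ u))
  image-edge i j = ⊆-antisym into back
    where
    g = ⁅ i ⁆ ∪ ⁅ j ⁆
    x = φ (i ↑ˡ u)
    y = φ (j ↑ˡ u)
    into : ∀ {z} → z ∈ˢ image φ (g Vec.++ ⊤) → z ∈ˢ join-edge apex x y
    into z∈ with ∈-image⁻ φ (g Vec.++ ⊤) z∈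
    ... | l , l∈ , refl with ∈ˢ-++⁻ g l∈
    ...   | inj₂ (v , v∈ , refl) = U⊆join-edge {U = apex} {x} {y} (∈-image⁺ φ _ (∈ˢ-++⁺ʳ (⊥ {t}) v∈))
    ...   | inj₁ (v , v∈ , refl) with x∈p∪q⁻ ⁅ i ⁆ ⁅ j ⁆ v∈
    ...     | inj₁ v∈i rewrite x∈⁅y⁆⇒x≡y i v∈i = x∈join-edge {U = apex} {x} {y}
    ...     | inj₂ v∈j rewrite x∈⁅y⁆⇒x≡y j v∈j = y∈join-edge {U = apex} {x} {y}
    back : ∀ {z} → z ∈ˢ join-edge apex x y → z ∈ˢ image φ (g Vec.++ ⊤)
    back z∈ with ∈-join-edge⁻ {U = apex} {x} {y} z∈
    ... | inj₁ refl        = ∈-image⁺ φ _ (∈ˢ-++⁺ˡ (x∈p∪q⁺ (inj₁ (x∈⁅x⁆ i))))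
    ... | inj₂ (inj₁ refl) = ∈-image⁺ φ _ (∈ˢ-++⁺ˡ (x∈p∪q⁺ {p = ⁅ i ⁆} (inj₂ (x∈⁅x⁆ j))))
    ... | inj₂ (inj₂ z∈U) with apex⁻ z∈U
    ...   | v , refl = ∈-image⁺ φ _ (∈ˢ-++⁺ʳ g ∈⊤)

module _ {N : ℕ} (u k : ℕ) (φ : Fin (2 + k + u) → Fin N) (inj : Injective _≡_ _≡_ φ) where

  base-proper : Copies.Proper N u k (apex (2 + k) u φ , base (2 + k) u φ)
  base-proper = small , Unique.tabulate⁺ {f = λ i → φ (i ↑ˡ u)} (λ {i} {j} eq → ↑ˡ-injective u i j (inj eq))
              , All.tabulate disjoint , length-tabulate (λ i → φ (i ↑ˡ u))
    where
    small : length (elements (apex (2 + k) u φ)) ≤ u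
    small = subst (length (elements (apex (2 + k) u φ)) ≤_) (length-tabulate _)
      (unique-⊆-length (elements-unique (apex (2 + k) u φ)) into)
      where
      into : ∀ {x} → x ∈ elements (apex (2 + k) u φ) → x ∈ tabulate (λ j → φ ((2 + k) ↑ʳ j))
      into x∈ with apex⁻ (2 + k) u φ (∈-elements⁻ x∈)
      ... | j , refl = ∈-tabulate⁺ j
    disjoint : ∀ {x} → x ∈ base (2 + k) u φ → x ∉ˢ apex (2 + k) u φ
    disjoint x∈ x∈U with base⁻ (2 + k) u φ x∈ | apex⁻ (2 + k) u φ x∈U
    ... | i , refl | j , eq = ↑ˡ≢↑ʳ i j (inj eq)

  -- The clique is sorted because `copies` takes its cliques from `combinations`; two distinct
  -- members of it come from a pair of distinct indices, which is an edge of K_t.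
  copy-constant : ∀ (χ : Colouring N) c → (∀ e → E (SK (2 + u) (2 + k)) e → χ (image φ e) ≡ c) →
                  All (λ e → χ e ≡ c) (suspension (apex (2 + k) u φ) (sort (base (2 + k) u φ)))
  copy-constant χ c constant = All.tabulate colour
    where
    colour : ∀ {e} → e ∈ suspension (apex (2 + k) u φ) (sort (base (2 + k) u φ)) → χ e ≡ c
    colour e∈ with ∈-suspension⁻ (sort-unique (base (2 + k) u φ)) e∈
    ... | x , y , x∈ , y∈ , x≢y , refl with base⁻ (2 + k) u φ (∈-sort⁻ x∈) | base⁻ (2 + k) u φ (∈-sort⁻ y∈)
    ...   | i , refl | j , refl = trans (cong χ (sym (image-edge (2 + k) u φ i j)))
            (constant _ (⁅ i ⁆ ∪ ⁅ j ⁆ , ∣pair∣≡2 {i = i} {j} (λ { refl → x≢y refl }) , refl))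

-- Lower bound: the local lemma applied to the copies.

double-predecessor : ∀ m → 0 < m → ∃ λ b → 0 < b × suc b ≡ 2 * m
double-predecessor (suc m) _ = m + suc m , ≤-trans (s≤s z≤n) (m≤n+m (suc m) m) , double m
  where
  double : ∀ m → 1 + (m + (1 + m)) ≡ 2 * (1 + m)
  double = solve-∀

-- Taking c = k = m in `bernoulli-below` gives (1 + 1/b)^m ≤ (m+m)/m = 2.
power-loss : ∀ b m → 0 < m → suc b ≡ 2 * m → suc b ^ m ≤ 2 * b ^ m
power-loss b m 0<m b≡ = *-cancelʳ-≤ (suc b ^ m) (2 * b ^ m) m ⦃ >-nonZero 0<m ⦄ (begin
  suc b ^ m * m      ≤⟨ bernoulli-below b m m (≤-reflexive (trans (cong (m +_) (sym (+-identityʳ m))) (sym b≡))) ⟩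
  b ^ m * (m + m)    ≡⟨ rearrange (b ^ m) m ⟩
  2 * b ^ m * m      ∎)
  where
  open ≤-Reasoning
  rearrange : ∀ x y → x * (y + y) ≡ 2 * x * y
  rearrange = solve-∀

-- The local lemma provides a colouring without monochromatic member of `copies`, whereas any
-- monochromatic embedding of the suspension would produce one.
¬Arrows-of-sparse : ∀ N u k m → pairCount (2 + k) ≡ m → 0 < m →
  4 * (2 * m) * ((2 + u) * (2 + u) * length (combinations k (allFin N))) ≤ 2 ^ m →
  ¬ Arrows N (SK (2 + u) (2 + k)) (SK (2 + u) (2 + k))
¬Arrows-of-sparse N u k m m≡ 0<m sparse arrows with double-predecessor m 0<m
... | b , 0<b , b≡ = refute (arrows (look χ))
  where
  open Copies N u k
  D = (2 + u) * (2 + u) * length (combinations k (allFin N))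
  open LocalLemma copies through b m D 0<b nonempty cover through-unique
    (λ B∈ → trans (through-length B∈) m≡) degree (power-loss b m 0<m b≡)
    (subst (λ x → 4 * x * D ≤ 2 ^ m) (sym b≡) sparse)
    using (exists-avoiding)
  χ = proj₁ exists-avoiding
  no-copy : ∀ {A} → A ∈ copies → ¬ Mono χ A
  no-copy = proj₂ exists-avoiding
  refute : HasCopy (look χ) true (SK (2 + u) (2 + k)) ⊎ HasCopy (look χ) false (SK (2 + u) (2 + k)) → ⊥₀
  refute (inj₁ (φ , inj , h)) = no-copy (copy∈copies (base-proper u k φ inj)) (inj₁ (copy-constant u k φ inj (look χ) true h))
  refute (inj₂ (φ , inj , h)) = no-copy (copy∈copies (base-proper u k φ inj)) (inj₂ (copy-constant u k φ inj (look χ) false h))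

-- Upper bound: the link of the last r - 2 vertices.

extend : ∀ {t N} u → (Fin t → Fin N) → Fin (t + u) → Fin (N + u)
extend {t} {N} u φ i = join N u (Sum.map₁ φ (splitAt t i))

module _ {t N : ℕ} (u : ℕ) (φ : Fin t → Fin N) where

  extend-↑ˡ : ∀ i → extend u φ (i ↑ˡ u) ≡ φ i ↑ˡ u
  extend-↑ˡ i = cong (join N u ∘ Sum.map₁ φ) (splitAt-↑ˡ t i u)

  extend-↑ʳ : ∀ j → extend u φ (t ↑ʳ j) ≡ N ↑ʳ j
  extend-↑ʳ j = cong (join N u ∘ Sum.map₁ φ) (splitAt-↑ʳ t u j)

  extend-injective : Injective _≡_ _≡_ φ → Injective _≡_ _≡_ (extend u φ)
  extend-injective inj {i} {j} eq with splitAt t i in eqi | splitAt t j in eqj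
  ... | inj₁ a | inj₁ c = trans (sym (splitAt⁻¹-↑ˡ eqi)) (trans (cong (_↑ˡ u) (inj (↑ˡ-injective u _ _ eq))) (splitAt⁻¹-↑ˡ eqj))
  ... | inj₂ a | inj₂ c = trans (sym (splitAt⁻¹-↑ʳ eqi)) (trans (cong (t ↑ʳ_) (↑ʳ-injective N _ _ eq)) (splitAt⁻¹-↑ʳ eqj))
  ... | inj₁ a | inj₂ c = contradiction eq (↑ˡ≢↑ʳ (φ a) c)
  ... | inj₂ a | inj₁ c = contradiction (sym eq) (↑ˡ≢↑ʳ (φ c) a)

  image-extend : ∀ g → image (extend u φ) (g Vec.++ ⊤ {u}) ≡ image φ g Vec.++ ⊤ {u}
  image-extend g = ⊆-antisym into back
    where
    into : ∀ {z} → z ∈ˢ image (extend u φ) (g Vec.++ ⊤) → z ∈ˢ image φ g Vec.++ ⊤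
    into z∈ with ∈-image⁻ (extend u φ) (g Vec.++ ⊤) z∈
    ... | l , l∈ , refl with ∈ˢ-++⁻ g l∈
    ...   | inj₁ (i , i∈ , refl) rewrite extend-↑ˡ i = ∈ˢ-++⁺ˡ (∈-image⁺ φ g i∈)
    ...   | inj₂ (j , _ , refl)  rewrite extend-↑ʳ j = ∈ˢ-++⁺ʳ (image φ g) ∈⊤
    back : ∀ {z} → z ∈ˢ image φ g Vec.++ ⊤ → z ∈ˢ image (extend u φ) (g Vec.++ ⊤)
    back z∈ with ∈ˢ-++⁻ (image φ g) z∈
    ... | inj₂ (j , _ , refl) =
      subst (_∈ˢ image (extend u φ) (g Vec.++ ⊤)) (extend-↑ʳ j) (∈-image⁺ (extend u φ) _ (∈ˢ-++⁺ʳ g ∈⊤))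
    ... | inj₁ (_ , v∈ , refl) with ∈-image⁻ φ g v∈
    ...   | i , i∈ , refl =
      subst (_∈ˢ image (extend u φ) (g Vec.++ ⊤)) (extend-↑ˡ i) (∈-image⁺ (extend u φ) _ (∈ˢ-++⁺ˡ i∈))

-- A set e of the first N vertices receives the colour of e together with all the last r - 2
-- vertices; a monochromatic clique for this colouring extends by sending apex to apex.
Arrows-suspension : ∀ r t N → Arrows N (K t) (K t) → Arrows (N + (r ∸ 2)) (SK r t) (SK r t)
Arrows-suspension r t N arrows χ = Sum.map lift lift (arrows (λ e → χ (e Vec.++ ⊤)))
  where
  lift : ∀ {c} → HasCopy (λ e → χ (e Vec.++ ⊤)) c (K t) → HasCopy χ c (SK r t)
  lift (φ , inj , h) = extend (r ∸ 2) φ , extend-injective (r ∸ 2) φ inj ,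
    λ { _ (g , g∈ , refl) → trans (cong χ (image-extend (r ∸ 2) φ g)) (h g g∈) }

-- By contraposition: if R ≤ (p/q) t √2^t, the sparseness condition holds and the arrow relation
-- fails.
lower-bound : ∀ u p q k₁ →
  (∀ k N L → k₁ ≤ k → k ! * L ≤ N ^ k →
    q * q * (N * N) ≤ p * p * ((2 + k) * (2 + k)) * 2 ^ (2 + k) →
    4 * (2 * pairCount (2 + k)) * ((2 + u) * (2 + u) * L) ≤ 2 ^ pairCount (2 + k)) →
  ∀ t R → 2 + k₁ ≤ t → Arrows R (SK (2 + u) t) (SK (2 + u) t) →
  p * p * (t * t) * 2 ^ t < q * q * (R * R)
lower-bound u p q k₁ numerics (suc (suc k)) R (s≤s (s≤s k₁≤k)) arrows = ≰⇒> λ R≤ →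
  ¬Arrows-of-sparse R u k (pairCount (2 + k)) refl (s≤s z≤n)
    (numerics k R (length (combinations k (allFin R))) k₁≤k few R≤) arrows
  where
  few : k ! * length (combinations k (allFin R)) ≤ R ^ k
  few = subst (λ l → k ! * length (combinations k (allFin R)) ≤ l ^ k)
          (length-tabulate {n = R} id) (length-combinations k (allFin R))

-- Since (n/(n+1))^(n+1) increases to 1/e, the condition on p, q, n is met for some n exactly when
-- p/q < √2/e. The first part then says that R > (p/q) t √2^t for all large t, which is the 1 + o(1)
-- bound in squared integer form.
theorem1p14 : ∀ (r : ℕ) → 3 ≤ r →
    (∀ (p q n : ℕ) → 1 ≤ p → 1 ≤ q → 1 ≤ n →
    p * p * (n + 1) ^ (2 * n + 2) < 2 * (q * q) * n ^ (2 * n + 2) →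
    Σ ℕ (λ T → ∀ (t R : ℕ) → T ≤ t → IsRamseyNumber (SK r t) (SK r t) R →
    p * p * (t * t) * 2 ^ t < q * q * (R * R)))
    × (∀ (t R R₂ : ℕ) → IsRamseyNumber (SK r t) (SK r t) R → IsRamseyNumber (K t) (K t) R₂ →
    R ≤ R₂ + (r ∸ 2))
theorem1p14 (suc zero) (s≤s ())
theorem1p14 (suc (suc u)) _ =
  (λ p q n 1≤p 1≤q 1≤n hyp →
    let k₁ , numerics = local-lemma-numerics (2 + u) p q n 1≤p 1≤q 1≤n hyp
    in 2 + k₁ , λ t R T≤t ramsey → lower-bound u p q k₁ numerics t R T≤t (proj₁ ramsey)) ,
  λ t R R₂ ramsey ramsey₂ →
    ≮⇒≥ λ lt → proj₂ ramsey _ lt (Arrows-suspension (2 + u) t R₂ (proj₁ ramsey₂))
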